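{- Every subframe spi-logic $L$ has the polynomial finite frame property; moreover, if $L$ is complete and finitely axiomatisable, then membership of sp-implications in $L$ is decidable in coNP.
   Context: Fix a signature $\mathcal R$ with diamonds $\Diamond_R$. Sp-formulas: built from propositional variables and $\top$ by $\wedge$ and the $\Diamond_R$; sp-implications $\sigma\to\tau$. A SLO is an algebra $(A,\wedge,\top,\Diamond_R)_R$ with $(A,\wedge,\top)$ a meet-semilattice with top and each $\Diamond_R$ monotone; it validates $\sigma\to\tau$ if $\sigma[\mathfrak a]\le\tau[\mathfrak a]$ for all valuations. A spi-logic is a set of the form $L=\mathsf{SPi}+\Sigma=\{\iota\mid\iota\text{ valid in every SLO validating }\Sigma\}$ for a set $\Sigma$ of sp-implications; it is finitely axiomatisable if $\Sigma$ can be taken finite. Frames $(W,R^{\mathfrak F})_R$ with standard Kripke semantics; a frame for $L$ is a frame validating all of $L$ (equivalently all of $\Sigma$). $L$ is complete if an sp-implication belongs to $L$ iff it is valid in all frames for $L$. $L$ is a subframe logic if the class of frames for $L$ is closed under subframes (restrictions of all relations to a non-empty subset of the domain). $L$ has the polynomial finite frame property if there is a polynomial bound such that every sp-implication $\iota$ that fails in some frame for $L$ also fails in a frame for $L$ of size polynomial in the size of $\iota$. -}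

module Defs where

open import Data.Fin using (Fin; zero)
open import Data.List using (List; foldr)
open import Data.List.Membership.Propositional using (_∈_)
open import Data.Nat using (ℕ; suc; _+_; _*_; _≤_)
open import Data.Nat.Binary using (ℕᵇ; zero; 2[1+_]; 1+[2_]; fromℕ)
open import Data.Product using (Σ-syntax; ∃-syntax; _×_; _,_)
open import Data.Refinement using (Refinement; value) renaming (_,_ to _,ᴿ_)
open import Data.Irrelevant using (pure)
open import Data.Unit using () renaming (⊤ to Unit)
open import Data.Vec using (Vec; []; _∷_; lookup)
open import Function.Bundles using (_⇔_; _↔_; _↣_; Injection)
open import Level using (0ℓ) renaming (suc to lsuc)
open import Relation.Binary.Core using (Rel)
open import Relation.Binary.Definitions using (Monotonic₁)
open import Relation.Binary.Lattice.Bundles using (BoundedMeetSemilattice)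
open import Relation.Binary.PropositionalEquality using (_≢_)
open import Relation.Nullary using (¬_)
open import Relation.Unary using (Pred; Satisfiable; _≐_)

------------------------------------------------------------------------
-- Sp-formulas and sp-implications

infix  5 _⟶_
infixr 7 _∧_

data SpFormula (𝓡 : Set) : Set where
  var : ℕ → SpFormula 𝓡
  ⊤   : SpFormula 𝓡
  _∧_ : SpFormula 𝓡 → SpFormula 𝓡 → SpFormula 𝓡
  ◇   : 𝓡 → SpFormula 𝓡 → SpFormula 𝓡

record SpImplication (𝓡 : Set) : Set where
  constructor _⟶_
  field
    antecedent : SpFormula 𝓡
    consequent : SpFormula 𝓡

-- Number of symbol occurrences; a variable counts as one symbol.
∣_∣ᶠ : ∀ {𝓡} → SpFormula 𝓡 → ℕ
∣ var _ ∣ᶠ = 1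
∣ ⊤ ∣ᶠ     = 1
∣ σ ∧ τ ∣ᶠ = suc (∣ σ ∣ᶠ + ∣ τ ∣ᶠ)
∣ ◇ _ σ ∣ᶠ = suc ∣ σ ∣ᶠ

∣_∣ⁱ : ∀ {𝓡} → SpImplication 𝓡 → ℕ
∣ σ ⟶ τ ∣ⁱ = suc (∣ σ ∣ᶠ + ∣ τ ∣ᶠ)

------------------------------------------------------------------------
-- Semilattices with monotone operators

record SLO (𝓡 : Set) : Set₁ where
  field
    semilattice : BoundedMeetSemilattice 0ℓ 0ℓ 0ℓ

  open BoundedMeetSemilattice semilattice public
    using (Carrier; _≈_) renaming (_≤_ to _≤ᴬ_; _∧_ to _∧ᴬ_; ⊤ to ⊤ᴬ)

  field
    ◇ᴬ     : 𝓡 → Carrier → Carrier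
    ◇-mono : ∀ R → Monotonic₁ _≤ᴬ_ _≤ᴬ_ (◇ᴬ R)

  infix 8 _[_]
  _[_] : SpFormula 𝓡 → (ℕ → Carrier) → Carrier
  var i   [ 𝔞 ] = 𝔞 i
  ⊤       [ 𝔞 ] = ⊤ᴬ
  (σ ∧ τ) [ 𝔞 ] = (σ [ 𝔞 ]) ∧ᴬ (τ [ 𝔞 ])
  ◇ R σ   [ 𝔞 ] = ◇ᴬ R (σ [ 𝔞 ])

infix 4 _⊨ᴬ_ _⊨_ _⊨*_

_⊨ᴬ_ : ∀ {𝓡} → SLO 𝓡 → SpImplication 𝓡 → Set
A ⊨ᴬ (σ ⟶ τ) = ∀ (𝔞 : ℕ → Carrier) → σ [ 𝔞 ] ≤ᴬ τ [ 𝔞 ]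
  where open SLO A

SPi+ : ∀ {𝓡} → Pred (SpImplication 𝓡) 0ℓ → Pred (SpImplication 𝓡) (lsuc 0ℓ)
SPi+ {𝓡} Σ ι = ∀ (A : SLO 𝓡) → (∀ κ → Σ κ → A ⊨ᴬ κ) → A ⊨ᴬ ι

IsSpiLogic : ∀ {𝓡} → Pred (SpImplication 𝓡) (lsuc 0ℓ) → Set₁
IsSpiLogic {𝓡} L = Σ[ Σ ∈ Pred (SpImplication 𝓡) 0ℓ ] L ≐ SPi+ Σ

FinitelyAxiomatisable : ∀ {𝓡} → Pred (SpImplication 𝓡) (lsuc 0ℓ) → Set₁
FinitelyAxiomatisable {𝓡} L = Σ[ Σ ∈ List (SpImplication 𝓡) ] L ≐ SPi+ (_∈ Σ)

------------------------------------------------------------------------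
-- Kripke semantics

record Frame (𝓡 : Set) : Set₁ where
  field
    W          : Set
    inhabitant : W
    rel        : 𝓡 → Rel W 0ℓ

  ⟦_⟧ : SpFormula 𝓡 → (ℕ → Pred W 0ℓ) → Pred W 0ℓ
  ⟦ var i ⟧ V w = V i w
  ⟦ ⊤     ⟧ V w = Unit
  ⟦ σ ∧ τ ⟧ V w = ⟦ σ ⟧ V w × ⟦ τ ⟧ V w
  ⟦ ◇ R σ ⟧ V w = ∃[ v ] rel R w v × ⟦ σ ⟧ V v

_⊨_ : ∀ {𝓡} → Frame 𝓡 → SpImplication 𝓡 → Set₁
F ⊨ (σ ⟶ τ) = ∀ V w → ⟦ σ ⟧ V w → ⟦ τ ⟧ V w
  where open Frame F

_⊨*_ : ∀ {𝓡} → Frame 𝓡 → Pred (SpImplication 𝓡) (lsuc 0ℓ) → Set₁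
F ⊨* L = ∀ ι → L ι → F ⊨ ι

-- Refinement makes membership in P proof-irrelevant, so the worlds of the
-- subframe are exactly the elements of the subset, without repetition.
restrict : ∀ {𝓡} (F : Frame 𝓡) (P : Pred (Frame.W F) 0ℓ) → Satisfiable P → Frame 𝓡
restrict F P (w , Pw) = record
  { W          = Refinement W P
  ; inhabitant = w ,ᴿ pure Pw
  ; rel        = λ R u v → rel R (value u) (value v)
  }
  where open Frame F

Complete : ∀ {𝓡} → Pred (SpImplication 𝓡) (lsuc 0ℓ) → Set₁
Complete {𝓡} L = ∀ ι → L ι ⇔ (∀ (F : Frame 𝓡) → F ⊨* L → F ⊨ ι)

SubframeLogic : ∀ {𝓡} → Pred (SpImplication 𝓡) (lsuc 0ℓ) → Set₁
SubframeLogic {𝓡} L =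
  ∀ (F : Frame 𝓡) (P : Pred (Frame.W F) 0ℓ) (ne : Satisfiable P) →
  F ⊨* L → restrict F P ne ⊨* L

-- The list a₀ ∷ a₁ ∷ … ∷ aₖ ∷ [] represents a₀ + a₁ n + … + aₖ nᵏ.
Polynomial : Set
Polynomial = List ℕ

_⟨_⟩ : Polynomial → ℕ → ℕ
p ⟨ n ⟩ = foldr (λ a r → a + n * r) 0 p

PolynomialFiniteFrameProperty : ∀ {𝓡} → Pred (SpImplication 𝓡) (lsuc 0ℓ) → Set₁
PolynomialFiniteFrameProperty {𝓡} L =
  Σ[ p ∈ Polynomial ] ∀ ι →
    (Σ[ F ∈ Frame 𝓡 ] F ⊨* L × ¬ (F ⊨ ι)) →
    (Σ[ F ∈ Frame 𝓡 ] F ⊨* L × ¬ (F ⊨ ι) ×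
      (∃[ n ] n ≤ p ⟨ ∣ ι ∣ⁱ ⟩ × (Frame.W F ↔ Fin n)))

------------------------------------------------------------------------
-- Polynomial time and coNP
--
-- The model of computation is that of first-order, call-by-value recursive
-- programs over binary trees (Jones, "Computability and Complexity from a
-- Programming Perspective", 1997), with unit cost per evaluation step.
-- Unit cost is legitimate although repeated use of t ∙ t yields trees of
-- exponential size: values are immutable and are only ever inspected at the
-- root, so an evaluation of t steps is carried out on a heap of shared cells
-- of which it allocates at most t, and a Turing machine simulates it in time
-- polynomial in t and the input size.  Conversely, a tape is a pair of lists,
-- so Turing machines are simulated with constant overhead per step.

infixr 6 _∙_

data Tree : Set where
  nil : Tree
  _∙_ : Tree → Tree → Tree

∣_∣ᵗ : Tree → ℕ
∣ nil ∣ᵗ   = 1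
∣ s ∙ t ∣ᵗ = suc (∣ s ∣ᵗ + ∣ t ∣ᵗ)

-- Expressions over m unary function symbols and n variables in scope; the
-- second branch of a case binds the left subtree as variable 0 and the right
-- subtree as variable 1.
data Expr (m n : ℕ) : Set where
  var  : Fin n → Expr m n
  nil  : Expr m n
  _∙_  : Expr m n → Expr m n → Expr m n
  case : Expr m n → Expr m n → Expr m (2 + n) → Expr m n
  call : Fin m → Expr m n → Expr m n

Program : ℕ → Set
Program m = Fin m → Expr m 1

-- P , ρ ⊢ e ⇓ v ∣ t : in the environment ρ, e evaluates to v in t steps.
data _,_⊢_⇓_∣_ {m : ℕ} (P : Program m) {n : ℕ} (ρ : Vec Tree n) :
               Expr m n → Tree → ℕ → Set where
  ⇓var  : ∀ {i} → P , ρ ⊢ var i ⇓ lookup ρ i ∣ 1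
  ⇓nil  : P , ρ ⊢ nil ⇓ nil ∣ 1
  ⇓∙    : ∀ {e₁ e₂ v₁ v₂ t₁ t₂} →
          P , ρ ⊢ e₁ ⇓ v₁ ∣ t₁ → P , ρ ⊢ e₂ ⇓ v₂ ∣ t₂ →
          P , ρ ⊢ e₁ ∙ e₂ ⇓ v₁ ∙ v₂ ∣ suc (t₁ + t₂)
  ⇓case-nil : ∀ {e e₁ e₂ v t t₁} →
          P , ρ ⊢ e ⇓ nil ∣ t → P , ρ ⊢ e₁ ⇓ v ∣ t₁ →
          P , ρ ⊢ case e e₁ e₂ ⇓ v ∣ suc (t + t₁)
  ⇓case-∙   : ∀ {e e₁ e₂ a b v t t₂} →
          P , ρ ⊢ e ⇓ a ∙ b ∣ t → P , a ∷ b ∷ ρ ⊢ e₂ ⇓ v ∣ t₂ →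
          P , ρ ⊢ case e e₁ e₂ ⇓ v ∣ suc (t + t₂)
  ⇓call : ∀ {f e a v t t₁} →
          P , ρ ⊢ e ⇓ a ∣ t → P , a ∷ [] ⊢ P f ⇓ v ∣ t₁ →
          P , ρ ⊢ call f e ⇓ v ∣ suc (t + t₁)

-- Function zero is the main function.
_[_]⇓_∣_ : ∀ {m} → Program (suc m) → Tree → Tree → ℕ → Set
P [ a ]⇓ v ∣ t = P , a ∷ [] ⊢ P zero ⇓ v ∣ t

Accepts : ∀ {m} → Program (suc m) → Tree → Set
Accepts P a = ∃[ v ] ∃[ t ] P [ a ]⇓ v ∣ t × v ≢ nil

-- A decision problem is a predicate on a type of instances together with a
-- representation of the instances as data.  NP is defined by polynomial-time
-- verification of certificates of polynomial size.
InNP : ∀ {I : Set} {ℓ} → (I → Tree) → Pred I ℓ → Set ℓ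
InNP {I} enc A =
  ∃[ m ] Σ[ P ∈ Program (suc m) ] Σ[ p ∈ Polynomial ] Σ[ q ∈ Polynomial ]
    (∀ x y → ∃[ v ] ∃[ t ] P [ enc x ∙ y ]⇓ v ∣ t × t ≤ q ⟨ ∣ enc x ∙ y ∣ᵗ ⟩) ×
    (∀ x → A x ⇔ (∃[ y ] ∣ y ∣ᵗ ≤ p ⟨ ∣ enc x ∣ᵗ ⟩ × Accepts P (enc x ∙ y)))

InCoNP : ∀ {I : Set} {ℓ} → (I → Tree) → Pred I ℓ → Set ℓ
InCoNP enc A = InNP enc (λ x → ¬ A x)

-- Indices of variables and (codes of) diamonds are written in binary.
encodeᵇ : ℕᵇ → Tree
encodeᵇ zero     = nil
encodeᵇ 2[1+ b ] = nil ∙ encodeᵇ b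
encodeᵇ 1+[2 b ] = (nil ∙ nil) ∙ encodeᵇ b

encodeℕ : ℕ → Tree
encodeℕ n = encodeᵇ (fromℕ n)

module _ {𝓡 : Set} (code : 𝓡 ↣ ℕ) where

  encodeᶠ : SpFormula 𝓡 → Tree
  encodeᶠ ⊤       = nil
  encodeᶠ (var i) = nil ∙ encodeℕ i
  encodeᶠ (σ ∧ τ) = (nil ∙ nil) ∙ (encodeᶠ σ ∙ encodeᶠ τ)
  encodeᶠ (◇ R σ) = ((nil ∙ nil) ∙ nil) ∙ (encodeℕ (Injection.to code R) ∙ encodeᶠ σ)

  encodeⁱ : SpImplication 𝓡 → Tree
  encodeⁱ (σ ⟶ τ) = encodeᶠ σ ∙ encodeᶠ τ

{-# OPTIONS --safe #-}
module Submission where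

-- If σ → τ fails at a world w of a frame for L, keep only w and one witness for
-- every diamond of σ: restricted to these at most ∣ σ ∣ worlds, σ stays true at w,
-- and τ stays false because sp-formulas are monotone.  The result is a frame for
-- L since L is a subframe logic.
--
-- A certificate for ι ∉ L is such a small frame with a valuation, restricted to the
-- symbols of ι and Σ.  Refutation of ι is checked by computing truth sets bottom-up.
-- Validity of an axiom σ → τ of Σ quantifies over exponentially many valuations, but
-- by monotonicity it is enough to test τ under the minimal valuations making σ true;
-- they are given by the homomorphisms from the tree of σ into the frame, and for a
-- fixed σ there are polynomially many.  An accepted certificate yields an SLO
-- (the subsets of its worlds) that validates Σ and refutes ι.

open import Defs
open import Axiom.ExcludedMiddle using (ExcludedMiddle)
open import Data.Fin using (Fin; zero; suc; toℕ; fromℕ<; _↑ˡ_; _↑ʳ_; splitAt)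
open import Data.Fin.Properties using (splitAt-↑ˡ; splitAt-↑ʳ; toℕ<n; toℕ-injective; toℕ-fromℕ<)
open import Data.Irrelevant using (pure) renaming ([_] to irrelevantly)
open import Data.List using (List; []; _∷_; _++_; length; map; deduplicate)
import Data.List as List
open import Data.List.Membership.Propositional using (_∈_)
import Data.List.Membership.Propositional.Properties as ∈ₚ
open import Data.List.Properties using (length-++; length-deduplicate)
open import Data.List.Relation.Unary.All using () renaming (lookup to All-lookup)
open import Data.List.Relation.Unary.AllPairs using (_∷_)
open import Data.List.Relation.Unary.Any using (here; there; index)
open import Data.List.Relation.Unary.Any.Properties using (lookup-index)
open import Data.List.Relation.Unary.Unique.Propositional using (Unique)
open import Data.List.Relation.Unary.Unique.DecPropositional.Properties using (deduplicate-!)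
open import Data.Nat using (ℕ; zero; suc; _+_; _*_; _≤_; _<_; z≤n; s≤s)
open import Data.Nat.Binary using (zero; 2[1+_]; 1+[2_]; fromℕ)
open import Data.Nat.Binary.Properties using (fromℕ-injective)
open import Data.Nat.Properties hiding (_≟_)
open import Data.Nat.Tactic.RingSolver using (solve-∀)
open import Data.Product using (Σ-syntax; ∃-syntax; _×_; _,_; proj₁; proj₂)
open import Data.Refinement using (Refinement; value; value-injective) renaming (_,_ to _,ᴿ_)
open import Data.Sum using (_⊎_; inj₁; inj₂; [_,_]′)
open import Data.Unit using (tt)
open import Data.Vec using (Vec; []; _∷_; lookup)
open import Function.Bundles using (_⇔_; _↔_; _↣_; Equivalence; Injection; Inverse; mk⇔; mk↔ₛ′)
open import Level using (0ℓ; lift; lower) renaming (suc to lsuc)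
open import Relation.Binary.Definitions using (DecidableEquality)
open import Relation.Binary.Lattice.Bundles using (BoundedMeetSemilattice)
open import Relation.Binary.PropositionalEquality using (_≡_; _≢_; refl; sym; trans; cong; cong₂; subst)
open import Relation.Nullary using (¬_; Dec; yes; no; contradiction)
open import Relation.Nullary.Decidable using (decidable-stable; map′; recompute)
open import Relation.Unary using (Pred; Satisfiable)

-- Small counterframes

lookup-injective : ∀ {A : Set} {xs : List A} → Unique xs →
                   ∀ {i j} → List.lookup xs i ≡ List.lookup xs j → i ≡ j
lookup-injective (_ ∷ _)   {zero}  {zero}  _ = refl
lookup-injective (x∉ ∷ _)  {zero}  {suc j} p = contradiction p (All-lookup x∉ (∈ₚ.∈-lookup j))
lookup-injective (x∉ ∷ _)  {suc i} {zero}  p = contradiction (sym p) (All-lookup x∉ (∈ₚ.∈-lookup i))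
lookup-injective (_ ∷ xs!) {suc i} {suc j} p = cong suc (lookup-injective xs! p)

-- A membership proof inside `Refinement` is irrelevant, so a position cannot be read off it;
-- decidability recomputes one. Uniqueness makes that position the original one in `to∘from`.
members↔Fin : ∀ {A : Set} {xs : List A} → (∀ x → Dec (x ∈ xs)) → Unique xs →
              Refinement A (_∈ xs) ↔ Fin (length xs)
members↔Fin {A} {xs} _∈?xs xs! = mk↔ₛ′ to from to∘from from∘to
  where
  position : (u : Refinement A (_∈ xs)) → value u ∈ xs
  position (x ,ᴿ irrelevantly p) = recompute (x ∈?xs) p
  to : Refinement A (_∈ xs) → Fin (length xs)
  to u = index (position u)
  from : Fin (length xs) → Refinement A (_∈ xs)
  from i = List.lookup xs i ,ᴿ pure (∈ₚ.∈-lookup i)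
  from∘to : ∀ u → from (to u) ≡ u
  from∘to u = value-injective (sym (lookup-index (position u)))
  to∘from : ∀ i → to (from i) ≡ i
  to∘from i = lookup-injective xs! (cong value (from∘to (from i)))

module _ {𝓡 : Set} (F : Frame 𝓡) (V : ℕ → Pred (Frame.W F) 0ℓ) where
  open Frame F

  -- The choice of witnesses is read off the proof of truth. The root `w` is not included.
  witnesses : ∀ σ {w} → ⟦ σ ⟧ V w → List W
  witnesses (var i) _           = []
  witnesses ⊤       _           = []
  witnesses (σ ∧ τ) (s , t)     = witnesses σ s ++ witnesses τ t
  witnesses (◇ R σ) (v , _ , s) = v ∷ witnesses σ s

  -- Strictness leaves room for the root, so that root and witnesses together number at most
  -- `∣ σ ∣ᶠ`.
  witnesses-length : ∀ σ {w} (s : ⟦ σ ⟧ V w) → length (witnesses σ s) < ∣ σ ∣ᶠ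
  witnesses-length (var i) _           = s≤s z≤n
  witnesses-length ⊤       _           = s≤s z≤n
  witnesses-length (σ ∧ τ) (s , t)     =
    s≤s (≤-trans (≤-reflexive (length-++ (witnesses σ s)))
                 (+-mono-≤ (<⇒≤ (witnesses-length σ s)) (<⇒≤ (witnesses-length τ t))))
  witnesses-length (◇ R σ) (v , _ , s) = s≤s (witnesses-length σ s)

  module _ (P : Pred W 0ℓ) (ne : Satisfiable P) where

    restrict-true : ∀ σ {w} (Pw : P w) (s : ⟦ σ ⟧ V w) → (∀ {v} → v ∈ witnesses σ s → P v) →
                    Frame.⟦_⟧ (restrict F P ne) σ (λ i u → V i (value u)) (w ,ᴿ pure Pw)
    restrict-true (var i) Pw s       _   = s
    restrict-true ⊤       Pw s       _   = tt
    restrict-true (σ ∧ τ) Pw (s , t) all =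
      restrict-true σ Pw s (λ v∈ → all (∈ₚ.∈-++⁺ˡ v∈)) ,
      restrict-true τ Pw t (λ v∈ → all (∈ₚ.∈-++⁺ʳ (witnesses σ s) v∈))
    restrict-true (◇ R σ) Pw (v , Rwv , s) all =
      (v ,ᴿ pure (all (here refl))) , Rwv , restrict-true σ (all (here refl)) s (λ v∈ → all (there v∈))

    -- A diamond witness in the subframe is also one in `F`, and sp-formulas have no connective that
    -- would reverse this.
    restrict-reflects : ∀ σ {u} → Frame.⟦_⟧ (restrict F P ne) σ (λ i u → V i (value u)) u →
                        ⟦ σ ⟧ V (value u)
    restrict-reflects (var i) s       = s
    restrict-reflects ⊤       s       = tt
    restrict-reflects (σ ∧ τ) (s , t) = restrict-reflects σ s , restrict-reflects τ t
    restrict-reflects (◇ R σ) (v , Rwv , s) = value v , Rwv , restrict-reflects σ s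

lowerEM : ExcludedMiddle (lsuc 0ℓ) → ExcludedMiddle 0ℓ
lowerEM em = map′ lower lift em

-- Excluded middle is applied one level up because the countermodel contains a valuation, which
-- lives in `Set₁`.
⊭⇒countermodel : ExcludedMiddle (lsuc 0ℓ) → ∀ {𝓡} (F : Frame 𝓡) σ τ → ¬ (F ⊨ (σ ⟶ τ)) →
  Σ[ V ∈ (ℕ → Pred (Frame.W F) 0ℓ) ] ∃[ w ] Frame.⟦_⟧ F σ V w × ¬ Frame.⟦_⟧ F τ V w
⊭⇒countermodel em F σ τ F⊭ with em
... | yes counter = counter
... | no  none    = contradiction (λ V w s → stable V w s em₀) F⊭
  where
  em₀ : ExcludedMiddle 0ℓ
  em₀ = lowerEM em
  stable : ∀ V w → Frame.⟦_⟧ F σ V w → Dec (Frame.⟦_⟧ F τ V w) → Frame.⟦_⟧ F τ V w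
  stable V w s (yes t) = t
  stable V w s (no ¬t) = contradiction (V , w , s , ¬t) none

smallCounterframe : ExcludedMiddle (lsuc 0ℓ) → ∀ {𝓡} {L : Pred (SpImplication 𝓡) (lsuc 0ℓ)} →
  SubframeLogic L → ∀ ι → (Σ[ F ∈ Frame 𝓡 ] F ⊨* L × ¬ (F ⊨ ι)) →
  Σ[ F ∈ Frame 𝓡 ] F ⊨* L × ¬ (F ⊨ ι) × (∃[ n ] n ≤ ∣ ι ∣ⁱ × (Frame.W F ↔ Fin n))
smallCounterframe em {𝓡} subframe (σ ⟶ τ) (F , F⊨L , F⊭ι)
  with V , w , s , ¬t ← ⊭⇒countermodel em F σ τ F⊭ι
  = restrict F (_∈ points) nonempty , subframe F (_∈ points) nonempty F⊨L ,
    (λ valid → ¬t (restrict-reflects F V (_∈ points) nonempty τ (valid _ _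
      (restrict-true F V (_∈ points) nonempty σ (inPoints (here refl)) s (λ v∈ → inPoints (there v∈)))))) ,
    length points , points≤ , members↔Fin (λ _ → em₀) (deduplicate-! _≟_ (w ∷ witnesses F V σ s))
  where
  em₀ : ExcludedMiddle 0ℓ
  em₀ = lowerEM em
  _≟_ : DecidableEquality (Frame.W F)
  x ≟ y = em₀
  points : List (Frame.W F)
  -- Witnesses of different diamonds may coincide; without repetitions the length of the list is the
  -- number of worlds.
  points = deduplicate _≟_ (w ∷ witnesses F V σ s)
  inPoints : ∀ {v} → v ∈ w ∷ witnesses F V σ s → v ∈ points
  inPoints = ∈ₚ.∈-deduplicate⁺ _≟_
  nonempty : Satisfiable (_∈ points)
  nonempty = w , inPoints (here refl)
  points≤ : length points ≤ ∣ σ ⟶ τ ∣ⁱ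
  points≤ = ≤-trans (length-deduplicate _≟_ (w ∷ witnesses F V σ s))
    (≤-trans (witnesses-length F V σ s) (m≤n⇒m≤1+n (m≤m+n _ _)))

-- Polynomial bounds

infixl 6 _⊕_
infixl 7 _⊗_
infixr 9 _⊚_

-- Bounds are kept as expressions, closed under composition and evaluated by computation;
-- coefficient lists are formed only for the final statements.
data Poly : Set where
  K   : ℕ → Poly
  X   : Poly
  _⊕_ : Poly → Poly → Poly
  _⊗_ : Poly → Poly → Poly
  _⊚_ : Poly → Poly → Poly

⟦_⟧ᵖ : Poly → ℕ → ℕ
⟦ K c ⟧ᵖ   n = c
⟦ X ⟧ᵖ     n = n
⟦ p ⊕ q ⟧ᵖ n = ⟦ p ⟧ᵖ n + ⟦ q ⟧ᵖ n
⟦ p ⊗ q ⟧ᵖ n = ⟦ p ⟧ᵖ n * ⟦ q ⟧ᵖ n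
⟦ p ⊚ q ⟧ᵖ n = ⟦ p ⟧ᵖ (⟦ q ⟧ᵖ n)

-- Coefficients are natural numbers. Monotonicity permits a size to be replaced by a bound on it.
⟦⟧ᵖ-mono : ∀ p {m n} → m ≤ n → ⟦ p ⟧ᵖ m ≤ ⟦ p ⟧ᵖ n
⟦⟧ᵖ-mono (K c)   m≤n = ≤-refl
⟦⟧ᵖ-mono X       m≤n = m≤n
⟦⟧ᵖ-mono (p ⊕ q) m≤n = +-mono-≤ (⟦⟧ᵖ-mono p m≤n) (⟦⟧ᵖ-mono q m≤n)
⟦⟧ᵖ-mono (p ⊗ q) m≤n = *-mono-≤ (⟦⟧ᵖ-mono p m≤n) (⟦⟧ᵖ-mono q m≤n)
⟦⟧ᵖ-mono (p ⊚ q) m≤n = ⟦⟧ᵖ-mono p (⟦⟧ᵖ-mono q m≤n)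

_+ᶜ_ : Polynomial → Polynomial → Polynomial
[]      +ᶜ q       = q
(a ∷ p) +ᶜ []      = a ∷ p
(a ∷ p) +ᶜ (b ∷ q) = a + b ∷ p +ᶜ q

_*ᶜ_ : Polynomial → Polynomial → Polynomial
[]      *ᶜ q = []
(a ∷ p) *ᶜ q = map (a *_) q +ᶜ (0 ∷ p *ᶜ q)

-- Horner's scheme, with `q` in place of the argument.
_∘ᶜ_ : Polynomial → Polynomial → Polynomial
[]      ∘ᶜ q = []
(a ∷ p) ∘ᶜ q = (a ∷ []) +ᶜ (q *ᶜ (p ∘ᶜ q))

+ᶜ-⟨⟩ : ∀ p q n → (p +ᶜ q) ⟨ n ⟩ ≡ p ⟨ n ⟩ + q ⟨ n ⟩
+ᶜ-⟨⟩ []      q       n = refl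
+ᶜ-⟨⟩ (a ∷ p) []      n = sym (+-identityʳ _)
+ᶜ-⟨⟩ (a ∷ p) (b ∷ q) n rewrite +ᶜ-⟨⟩ p q n = lemma a b n (p ⟨ n ⟩) (q ⟨ n ⟩)
  where
  lemma : ∀ a b n x y → (a + b) + n * (x + y) ≡ (a + n * x) + (b + n * y)
  lemma = solve-∀

map-*-⟨⟩ : ∀ a q n → map (a *_) q ⟨ n ⟩ ≡ a * q ⟨ n ⟩
map-*-⟨⟩ a []      n = sym (*-zeroʳ a)
map-*-⟨⟩ a (b ∷ q) n rewrite map-*-⟨⟩ a q n = lemma a b n (q ⟨ n ⟩)
  where
  lemma : ∀ a b n x → a * b + n * (a * x) ≡ a * (b + n * x)
  lemma = solve-∀

*ᶜ-⟨⟩ : ∀ p q n → (p *ᶜ q) ⟨ n ⟩ ≡ p ⟨ n ⟩ * q ⟨ n ⟩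
*ᶜ-⟨⟩ []      q n = refl
*ᶜ-⟨⟩ (a ∷ p) q n
  rewrite +ᶜ-⟨⟩ (map (a *_) q) (0 ∷ p *ᶜ q) n | map-*-⟨⟩ a q n | *ᶜ-⟨⟩ p q n
  = lemma a n (p ⟨ n ⟩) (q ⟨ n ⟩)
  where
  lemma : ∀ a n x y → a * y + n * (x * y) ≡ (a + n * x) * y
  lemma = solve-∀

∘ᶜ-⟨⟩ : ∀ p q n → (p ∘ᶜ q) ⟨ n ⟩ ≡ p ⟨ q ⟨ n ⟩ ⟩
∘ᶜ-⟨⟩ []      q n = refl
∘ᶜ-⟨⟩ (a ∷ p) q n
  rewrite +ᶜ-⟨⟩ (a ∷ []) (q *ᶜ (p ∘ᶜ q)) n | *ᶜ-⟨⟩ q (p ∘ᶜ q) n | ∘ᶜ-⟨⟩ p q n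
  = cong (_+ q ⟨ n ⟩ * p ⟨ q ⟨ n ⟩ ⟩) (trans (cong (a +_) (*-zeroʳ n)) (+-identityʳ a))

coefficients : Poly → Polynomial
coefficients (K c)   = c ∷ []
coefficients X       = 0 ∷ 1 ∷ []
coefficients (p ⊕ q) = coefficients p +ᶜ coefficients q
coefficients (p ⊗ q) = coefficients p *ᶜ coefficients q
coefficients (p ⊚ q) = coefficients p ∘ᶜ coefficients q

X-⟨⟩ : ∀ n → (0 ∷ 1 ∷ []) ⟨ n ⟩ ≡ n
X-⟨⟩ n rewrite *-zeroʳ n = *-identityʳ n

coefficients-⟨⟩ : ∀ p n → coefficients p ⟨ n ⟩ ≡ ⟦ p ⟧ᵖ n
coefficients-⟨⟩ (K c)   n = trans (cong (c +_) (*-zeroʳ n)) (+-identityʳ c)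
coefficients-⟨⟩ X       n = X-⟨⟩ n
coefficients-⟨⟩ (p ⊕ q) n = trans (+ᶜ-⟨⟩ (coefficients p) (coefficients q) n)
  (cong₂ _+_ (coefficients-⟨⟩ p n) (coefficients-⟨⟩ q n))
coefficients-⟨⟩ (p ⊗ q) n = trans (*ᶜ-⟨⟩ (coefficients p) (coefficients q) n)
  (cong₂ _*_ (coefficients-⟨⟩ p n) (coefficients-⟨⟩ q n))
coefficients-⟨⟩ (p ⊚ q) n = trans (∘ᶜ-⟨⟩ (coefficients p) (coefficients q) n)
  (trans (cong (coefficients p ⟨_⟩) (coefficients-⟨⟩ q n)) (coefficients-⟨⟩ p (⟦ q ⟧ᵖ n)))

-- Evaluation of programs

-- `Accepts` only provides some evaluation; this identifies its value with that of the known run of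
-- the verifier.
⇓-deterministic : ∀ {m n} {P : Program m} {ρ : Vec Tree n} {e u v s t} →
  P , ρ ⊢ e ⇓ u ∣ s → P , ρ ⊢ e ⇓ v ∣ t → u ≡ v
⇓-deterministic ⇓var ⇓var = refl
⇓-deterministic ⇓nil ⇓nil = refl
⇓-deterministic (⇓∙ d₁ d₂) (⇓∙ e₁ e₂) = cong₂ _∙_ (⇓-deterministic d₁ e₁) (⇓-deterministic d₂ e₂)
⇓-deterministic (⇓case-nil d₁ d₂) (⇓case-nil e₁ e₂) = ⇓-deterministic d₂ e₂
⇓-deterministic (⇓case-nil d₁ d₂) (⇓case-∙ e₁ e₂) with () ← ⇓-deterministic d₁ e₁
⇓-deterministic (⇓case-∙ d₁ d₂) (⇓case-nil e₁ e₂) with () ← ⇓-deterministic d₁ e₁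
⇓-deterministic (⇓case-∙ d₁ d₂) (⇓case-∙ e₁ e₂) with refl ← ⇓-deterministic d₁ e₁ =
  ⇓-deterministic d₂ e₂
⇓-deterministic (⇓call d₁ d₂) (⇓call e₁ e₂) with refl ← ⇓-deterministic d₁ e₁ =
  ⇓-deterministic d₂ e₂

rename : ∀ {m m′ n} → (Fin m → Fin m′) → Expr m n → Expr m′ n
rename r (var i)        = var i
rename r nil            = nil
rename r (e₁ ∙ e₂)      = rename r e₁ ∙ rename r e₂
rename r (case e e₁ e₂) = case (rename r e) (rename r e₁) (rename r e₂)
rename r (call f e)     = call (r f) (rename r e)

-- A program can thus be embedded in one with more function symbols at no extra cost.
⇓-rename : ∀ {m m′ n} {P : Program m} {P′ : Program m′} (r : Fin m → Fin m′) →
  (∀ f → P′ (r f) ≡ rename r (P f)) →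
  ∀ {ρ : Vec Tree n} {e v t} → P , ρ ⊢ e ⇓ v ∣ t → P′ , ρ ⊢ rename r e ⇓ v ∣ t
⇓-rename r eq ⇓var             = ⇓var
⇓-rename r eq ⇓nil             = ⇓nil
⇓-rename r eq (⇓∙ d₁ d₂)       = ⇓∙ (⇓-rename r eq d₁) (⇓-rename r eq d₂)
⇓-rename r eq (⇓case-nil d d₁) = ⇓case-nil (⇓-rename r eq d) (⇓-rename r eq d₁)
⇓-rename r eq (⇓case-∙ d d₂)   = ⇓case-∙ (⇓-rename r eq d) (⇓-rename r eq d₂)
⇓-rename {P′ = P′} r eq (⇓call {f = f} {a = a} {v} {t₁ = t} d d₁) =
  ⇓call (⇓-rename r eq d)
        (subst (λ e → P′ , a ∷ [] ⊢ e ⇓ v ∣ t) (sym (eq f)) (⇓-rename r eq d₁))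

Within : ∀ {m n} → Program m → Vec Tree n → Expr m n → Tree → ℕ → Set
Within P ρ e v T = ∃[ t ] P , ρ ⊢ e ⇓ v ∣ t × t ≤ T

module _ {m n} {P : Program m} {ρ : Vec Tree n} where

  within-≤ : ∀ {e v S T} → S ≤ T → Within P ρ e v S → Within P ρ e v T
  within-≤ S≤T (t , d , t≤S) = t , d , ≤-trans t≤S S≤T

  within-var : ∀ i → Within P ρ (var i) (lookup ρ i) 1
  within-var i = 1 , ⇓var , ≤-refl

  within-nil : Within P ρ nil nil 1
  within-nil = 1 , ⇓nil , ≤-refl

  within-∙ : ∀ {e₁ e₂ v₁ v₂ T₁ T₂} → Within P ρ e₁ v₁ T₁ → Within P ρ e₂ v₂ T₂ →
             Within P ρ (e₁ ∙ e₂) (v₁ ∙ v₂) (suc (T₁ + T₂))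
  within-∙ (_ , d₁ , t₁≤) (_ , d₂ , t₂≤) = _ , ⇓∙ d₁ d₂ , s≤s (+-mono-≤ t₁≤ t₂≤)

  within-case-nil : ∀ {e e₁ e₂ v T T₁} → Within P ρ e nil T → Within P ρ e₁ v T₁ →
                    Within P ρ (case e e₁ e₂) v (suc (T + T₁))
  within-case-nil (_ , d , t≤) (_ , d₁ , t₁≤) = _ , ⇓case-nil d d₁ , s≤s (+-mono-≤ t≤ t₁≤)

  within-case-∙ : ∀ {e e₁ e₂ a b v T T₂} → Within P ρ e (a ∙ b) T → Within P (a ∷ b ∷ ρ) e₂ v T₂ →
                  Within P ρ (case e e₁ e₂) v (suc (T + T₂))
  within-case-∙ (_ , d , t≤) (_ , d₂ , t₂≤) = _ , ⇓case-∙ d d₂ , s≤s (+-mono-≤ t≤ t₂≤)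

  within-call : ∀ {f e a v T T₁} → Within P ρ e a T → Within P (a ∷ []) (P f) v T₁ →
                Within P ρ (call f e) v (suc (T + T₁))
  within-call (_ , d , t≤) (_ , d₁ , t₁≤) = _ , ⇓call d d₁ , s≤s (+-mono-≤ t≤ t₁≤)

-- Functions computable in polynomial time

-- The size of the output has to be bounded separately: sharing makes it
-- possible to build a tree of exponential size in linear time.
record PolyTime (f : Tree → Tree) : Set where
  field
    {functions} : ℕ
    program : Program (suc functions)
    time    : Poly
    size    : Poly
    runs    : ∀ x → Within program (x ∷ []) (program zero) (f x) (⟦ time ⟧ᵖ ∣ x ∣ᵗ)
    bounded : ∀ x → ∣ f x ∣ᵗ ≤ ⟦ size ⟧ᵖ ∣ x ∣ᵗ

open PolyTime

fst : Tree → Tree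
fst nil     = nil
fst (a ∙ b) = a

snd : Tree → Tree
snd nil     = nil
snd (a ∙ b) = b

if-nil : Tree → Tree → Tree → Tree
if-nil nil     x y = x
if-nil (_ ∙ _) x y = y

1≤∣∣ᵗ : ∀ x → 1 ≤ ∣ x ∣ᵗ
1≤∣∣ᵗ nil     = ≤-refl
1≤∣∣ᵗ (_ ∙ _) = s≤s z≤n

∣fst∣≤ : ∀ x → ∣ fst x ∣ᵗ ≤ ∣ x ∣ᵗ
∣fst∣≤ nil     = ≤-refl
∣fst∣≤ (a ∙ b) = m≤n⇒m≤1+n (m≤m+n _ _)

∣snd∣≤ : ∀ x → ∣ snd x ∣ᵗ ≤ ∣ x ∣ᵗ
∣snd∣≤ nil     = ≤-refl
∣snd∣≤ (a ∙ b) = m≤n⇒m≤1+n (m≤n+m _ ∣ a ∣ᵗ)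

idᵖ : PolyTime (λ x → x)
idᵖ .functions = 0
idᵖ .program _ = var zero
idᵖ .time      = K 1
idᵖ .size      = X
idᵖ .runs x    = within-var zero
idᵖ .bounded x = ≤-refl

nilᵖ : PolyTime (λ _ → nil)
nilᵖ .functions = 0
nilᵖ .program _ = nil
nilᵖ .time      = K 1
nilᵖ .size      = K 1
nilᵖ .runs x    = within-nil
nilᵖ .bounded x = ≤-refl

fstᵖ : PolyTime fst
fstᵖ .functions    = 0
fstᵖ .program _    = case (var zero) nil (var zero)
fstᵖ .time         = K 3
fstᵖ .size         = X
fstᵖ .runs nil     = within-case-nil (within-var zero) within-nil
fstᵖ .runs (a ∙ b) = within-case-∙ (within-var zero) (within-var zero)
fstᵖ .bounded      = ∣fst∣≤

sndᵖ : PolyTime snd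
sndᵖ .functions    = 0
sndᵖ .program _    = case (var zero) nil (var (suc zero))
sndᵖ .time         = K 3
sndᵖ .size         = X
sndᵖ .runs nil     = within-case-nil (within-var zero) within-nil
sndᵖ .runs (a ∙ b) = within-case-∙ (within-var zero) (within-var (suc zero))
sndᵖ .bounded      = ∣snd∣≤

-- Symbol zero is a new main function with body `e`, which may also call itself; the functions of
-- `F` and `G` follow in two separate blocks.
module Link {f g} (F : PolyTime f) (G : PolyTime g) where

  symbols : ℕ
  symbols = suc (functions F) + suc (functions G)

  inˡ : Fin (suc (functions F)) → Fin (suc symbols)
  inˡ i = suc (i ↑ˡ suc (functions G))

  inʳ : Fin (suc (functions G)) → Fin (suc symbols)
  inʳ j = suc (suc (functions F) ↑ʳ j)

  call-f call-g : ∀ {n} → Expr (suc symbols) n → Expr (suc symbols) n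
  call-f = call (inˡ zero)
  call-g = call (inʳ zero)

  link : Expr (suc symbols) 1 → Program (suc symbols)
  link e zero    = e
  link e (suc i) = [ (λ j → rename inˡ (program F j)) , (λ j → rename inʳ (program G j)) ]′
                     (splitAt (suc (functions F)) i)

  link-inˡ : ∀ e i → link e (inˡ i) ≡ rename inˡ (program F i)
  link-inˡ e i = cong [ (λ j → rename inˡ (program F j)) , (λ j → rename inʳ (program G j)) ]′
                      (splitAt-↑ˡ (suc (functions F)) i (suc (functions G)))

  link-inʳ : ∀ e j → link e (inʳ j) ≡ rename inʳ (program G j)
  link-inʳ e j = cong [ (λ j → rename inˡ (program F j)) , (λ j → rename inʳ (program G j)) ]′
                      (splitAt-↑ʳ (suc (functions F)) (suc (functions G)) j)

  module _ {e : Expr (suc symbols) 1} where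

    within-f : ∀ x → Within (link e) (x ∷ []) (link e (inˡ zero)) (f x) (⟦ time F ⟧ᵖ ∣ x ∣ᵗ)
    within-f x rewrite link-inˡ e zero with runs F x
    ... | t , d , t≤ = t , ⇓-rename inˡ (link-inˡ e) d , t≤

    within-g : ∀ x → Within (link e) (x ∷ []) (link e (inʳ zero)) (g x) (⟦ time G ⟧ᵖ ∣ x ∣ᵗ)
    within-g x rewrite link-inʳ e zero with runs G x
    ... | t , d , t≤ = t , ⇓-rename inʳ (link-inʳ e) d , t≤

    within-call-f : ∀ {n} {ρ : Vec Tree n} {e′ x T} → Within (link e) ρ e′ x T →
                    Within (link e) ρ (call-f e′) (f x) (suc (T + ⟦ time F ⟧ᵖ ∣ x ∣ᵗ))
    within-call-f w = within-call w (within-f _)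

    within-call-g : ∀ {n} {ρ : Vec Tree n} {e′ x T} → Within (link e) ρ e′ x T →
                    Within (link e) ρ (call-g e′) (g x) (suc (T + ⟦ time G ⟧ᵖ ∣ x ∣ᵗ))
    within-call-g w = within-call w (within-g _)

module _ {f g} (F : PolyTime f) (G : PolyTime g) where

  private
    module L = Link F G

  pairᵖ : PolyTime (λ x → f x ∙ g x)
  pairᵖ .functions = _
  pairᵖ .program   = L.link (L.call-f (var zero) ∙ L.call-g (var zero))
  -- One step for the cons and, for either component, one for the call and one for the variable.
  pairᵖ .time      = K 5 ⊕ (time F ⊕ time G)
  pairᵖ .size      = K 1 ⊕ (size F ⊕ size G)
  pairᵖ .runs x    = within-≤ (≤-reflexive (arith (⟦ time F ⟧ᵖ ∣ x ∣ᵗ) (⟦ time G ⟧ᵖ ∣ x ∣ᵗ)))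
    (within-∙ (L.within-call-f (within-var zero)) (L.within-call-g (within-var zero)))
    where
    arith : ∀ a b → suc (suc (1 + a) + suc (1 + b)) ≡ 5 + (a + b)
    arith = solve-∀
  pairᵖ .bounded x = s≤s (+-mono-≤ (bounded F x) (bounded G x))

  composeᵖ : PolyTime (λ x → f (g x))
  composeᵖ .functions = _
  composeᵖ .program   = L.link (L.call-f (L.call-g (var zero)))
  -- Two calls and a variable; `F` runs on the output of `g`, so its time is taken at the bound on
  -- that output.
  composeᵖ .time      = K 3 ⊕ time G ⊕ time F ⊚ size G
  composeᵖ .size      = size F ⊚ size G
  composeᵖ .runs x    =
    within-≤ (+-monoʳ-≤ (3 + ⟦ time G ⟧ᵖ ∣ x ∣ᵗ) (⟦⟧ᵖ-mono (time F) (bounded G x)))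
      (L.within-call-f (L.within-call-g (within-var zero)))
  composeᵖ .bounded x = ≤-trans (bounded F (g x)) (⟦⟧ᵖ-mono (size F) (bounded G x))

  -- The condition travels as the left component of the input, so only the selected branch is run.
  -- The input `nil` behaves as `nil ∙ nil`.
  branchᵖ : PolyTime (λ x → if-nil (fst x) (f (snd x)) (g (snd x)))
  branchᵖ .functions = _
  branchᵖ .program   = L.link
    (case (var zero) (L.call-f nil)
      (case (var zero) (L.call-f (var (suc zero)))
        (L.call-g (var (suc (suc (suc zero)))))))
  branchᵖ .time      = K 6 ⊕ (time F ⊕ time G)
  branchᵖ .size      = size F ⊕ size G
  branchᵖ .runs nil  = within-≤ (+-mono-≤ (m≤m+n 4 2) (m≤m+n (⟦ time F ⟧ᵖ 1) _))
    (within-case-nil (within-var zero) (L.within-call-f within-nil))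
  branchᵖ .runs x@(nil ∙ b) =
    within-≤ (+-mono-≤ (≤-refl {6}) (≤-trans (⟦⟧ᵖ-mono (time F) (∣snd∣≤ x)) (m≤m+n _ _)))
      (within-case-∙ (within-var zero) (within-case-nil (within-var zero) (L.within-call-f (within-var _))))
  branchᵖ .runs x@((_ ∙ _) ∙ b) =
    within-≤ (+-mono-≤ (≤-refl {6}) (≤-trans (⟦⟧ᵖ-mono (time G) (∣snd∣≤ x)) (m≤n+m _ (⟦ time F ⟧ᵖ ∣ x ∣ᵗ))))
      (within-case-∙ (within-var zero) (within-case-∙ (within-var zero) (L.within-call-g (within-var _))))
  branchᵖ .bounded nil  = ≤-trans (bounded F nil) (m≤m+n _ _)
  branchᵖ .bounded x@(nil ∙ b) =
    ≤-trans (bounded F b) (≤-trans (⟦⟧ᵖ-mono (size F) (∣snd∣≤ x)) (m≤m+n _ _))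
  branchᵖ .bounded x@((_ ∙ _) ∙ b) =
    ≤-trans (bounded G b) (≤-trans (⟦⟧ᵖ-mono (size G) (∣snd∣≤ x)) (m≤n+m _ (⟦ size F ⟧ᵖ ∣ x ∣ᵗ)))

-- Cobham's bounded recursion: the size of the result has to be bounded in
-- advance, and then every node of the tree costs one call of the step.
module _ {base step : Tree → Tree} (B : PolyTime base) (S : PolyTime step)
         (h : Tree → Tree → Tree)
         (h-nil : ∀ env → h env nil ≡ base env)
         (h-∙ : ∀ env a b → h env (a ∙ b) ≡ step (env ∙ (a ∙ b) ∙ h env a ∙ h env b))
         (s : Poly) (h-bounded : ∀ env t → ∣ h env t ∣ᵗ ≤ ⟦ s ⟧ᵖ ∣ env ∙ t ∣ᵗ) where

  private
    module L = Link B S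

    body : Expr (suc L.symbols) 1
    -- The input is `env ∙ t`. In the innermost branch the variables are the two subtrees of `t`,
    -- then `env`, then `t`.
    body = case (var zero) (L.call-f nil)
      (case (var (suc zero)) (L.call-f (var zero))
        (L.call-g (var two ∙ var (suc two) ∙
          call zero (var two ∙ var zero) ∙ call zero (var two ∙ var (suc zero)))))
      where
      two : ∀ {n} → Fin (3 + n)
      two = suc (suc zero)

    argument : Poly
    -- Three conses join `env`, the current subtree and the two recursive values.
    argument = K 3 ⊕ X ⊕ (s ⊕ s)

    node : Poly
    -- 18 is the overhead at an inner node; a leaf needs only 6.
    node = K 18 ⊕ (time B ⊕ time S ⊚ argument)

    -- `N` stays fixed along the recursion, so every node is charged the same amount, and `∣ t ∣ᵗ`
    -- counts the nodes.
    recursion : ∀ N env t → ∣ env ∙ t ∣ᵗ ≤ N →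
                Within (L.link body) (env ∙ t ∷ []) body (h env t) (∣ t ∣ᵗ * ⟦ node ⟧ᵖ N)
    recursion N env nil ≤N rewrite h-nil env = within-≤ (≤-trans cost (m≤m+n _ 0))
      (within-case-∙ (within-var zero) (within-case-nil (within-var (suc zero))
        (L.within-call-f (within-var zero))))
      where
      cost : 6 + ⟦ time B ⟧ᵖ ∣ env ∣ᵗ ≤ ⟦ node ⟧ᵖ N
      cost = +-mono-≤ (m≤m+n 6 12)
        (≤-trans (⟦⟧ᵖ-mono (time B) (≤-trans (∣fst∣≤ (env ∙ nil)) ≤N)) (m≤m+n _ _))
    recursion N env (a ∙ b) ≤N rewrite h-∙ env a b =
      within-≤ (≤-trans (≤-reflexive (arith (∣ a ∣ᵗ * ⟦ node ⟧ᵖ N) (∣ b ∣ᵗ * ⟦ node ⟧ᵖ N) (⟦ time S ⟧ᵖ ∣ x ∣ᵗ)))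
                        cost)
        (within-case-∙ (within-var zero) (within-case-∙ (within-var (suc zero))
          (L.within-call-g (within-∙ (within-var _) (within-∙ (within-var _) (within-∙
            (within-call (within-∙ (within-var _) (within-var _)) (recursion N env a a≤N))
            (within-call (within-∙ (within-var _) (within-var _)) (recursion N env b b≤N))))))))
      where
      x : Tree
      x = env ∙ (a ∙ b) ∙ h env a ∙ h env b
      a≤N : ∣ env ∙ a ∣ᵗ ≤ N
      a≤N = ≤-trans (s≤s (+-monoʳ-≤ ∣ env ∣ᵗ (∣fst∣≤ (a ∙ b)))) ≤N
      b≤N : ∣ env ∙ b ∣ᵗ ≤ N
      b≤N = ≤-trans (s≤s (+-monoʳ-≤ ∣ env ∣ᵗ (∣snd∣≤ (a ∙ b)))) ≤N
      regroup : ∀ e t u v → suc (e + suc (t + suc (u + v))) ≡ 3 + (e + t) + (u + v)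
      regroup = solve-∀
      x≤ : ∣ x ∣ᵗ ≤ ⟦ argument ⟧ᵖ N
      x≤ = ≤-trans (≤-reflexive (regroup ∣ env ∣ᵗ ∣ a ∙ b ∣ᵗ ∣ h env a ∣ᵗ ∣ h env b ∣ᵗ))
        (+-mono-≤ (+-monoʳ-≤ 3 (≤-trans (n≤1+n _) ≤N))
          (+-mono-≤ (≤-trans (h-bounded env a) (⟦⟧ᵖ-mono s a≤N))
                    (≤-trans (h-bounded env b) (⟦⟧ᵖ-mono s b≤N))))
      arith : ∀ u v w → suc (1 + suc (1 + suc (suc (1 + suc (1 + suc (suc (3 + u) + suc (3 + v)))) + w)))
                        ≡ 18 + w + (u + v)
      arith = solve-∀
      cost : 18 + ⟦ time S ⟧ᵖ ∣ x ∣ᵗ + (∣ a ∣ᵗ * ⟦ node ⟧ᵖ N + ∣ b ∣ᵗ * ⟦ node ⟧ᵖ N)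
             ≤ ∣ a ∙ b ∣ᵗ * ⟦ node ⟧ᵖ N
      cost = +-mono-≤
        (+-monoʳ-≤ 18 (≤-trans (⟦⟧ᵖ-mono (time S) x≤) (m≤n+m _ (⟦ time B ⟧ᵖ N))))
        (≤-reflexive (sym (*-distribʳ-+ (⟦ node ⟧ᵖ N) ∣ a ∣ᵗ ∣ b ∣ᵗ)))

  recᵖ : PolyTime (λ x → h (fst x) (snd x))
  recᵖ .functions    = _
  recᵖ .program      = L.link body
  recᵖ .time         = X ⊗ node
  -- The input `nil` is read as `nil ∙ nil`, whose size is larger by 2.
  recᵖ .size         = s ⊚ (K 2 ⊕ X)
  recᵖ .runs nil rewrite h-nil nil = within-≤ (≤-trans cost (m≤m+n _ 0))
    (within-case-nil (within-var zero) (L.within-call-f within-nil))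
    where
    cost : 4 + ⟦ time B ⟧ᵖ 1 ≤ ⟦ node ⟧ᵖ 1
    cost = +-mono-≤ (m≤m+n 4 14) (m≤m+n _ _)
  recᵖ .runs x@(env ∙ t) = within-≤ (*-monoˡ-≤ (⟦ node ⟧ᵖ ∣ x ∣ᵗ) (∣snd∣≤ x)) (recursion _ env t ≤-refl)
  recᵖ .bounded nil       = h-bounded nil nil
  recᵖ .bounded (env ∙ t) = ≤-trans (h-bounded env t) (⟦⟧ᵖ-mono s (m≤n+m _ 2))

constᵖ : ∀ t → PolyTime (λ _ → t)
constᵖ nil     = nilᵖ
constᵖ (s ∙ t) = pairᵖ (constᵖ s) (constᵖ t)

ifᵖ : ∀ {c f g} → PolyTime c → PolyTime f → PolyTime g → PolyTime (λ x → if-nil (c x) (f x) (g x))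
ifᵖ C F G = composeᵖ (branchᵖ F G) (pairᵖ C idᵖ)

-- Trees as truth values: nil is false, everything else is true.

true : Tree
true = nil ∙ nil

infixr 6 _and_

_and_ : Tree → Tree → Tree
s and t = if-nil s nil t

not : Tree → Tree
not t = if-nil t true nil

andᵖ : ∀ {f g} → PolyTime f → PolyTime g → PolyTime (λ x → f x and g x)
andᵖ F G = ifᵖ F nilᵖ G

notᵖ : ∀ {f} → PolyTime f → PolyTime (λ x → not (f x))
notᵖ F = ifᵖ F (constᵖ true) nilᵖ

eq : Tree → Tree → Tree
eq nil     nil     = true
eq nil     (_ ∙ _) = nil
eq (_ ∙ _) nil     = nil
eq (a ∙ b) (c ∙ d) = eq a c and eq b d

-- `1 ≤ T` pays for returning `nil` when `x` is false.
within-and : ∀ {m n} {P : Program m} {ρ : Vec Tree n} {e e′ x y S T} → Within P ρ e x S →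
             (∀ a b → Within P (a ∷ b ∷ ρ) e′ y T) → 1 ≤ T →
             Within P ρ (case e nil e′) (x and y) (suc (S + T))
within-and {x = nil}   w w′ 1≤T = within-≤ (s≤s (+-monoʳ-≤ _ 1≤T)) (within-case-nil w within-nil)
within-and {x = a ∙ b} w w′ 1≤T = within-case-∙ w (w′ a b)

private
  -- Equality descends in both arguments at once, unlike `recᵖ`, so its program is written out.
  eq-body : Expr 1 1
  eq-body = case (var zero) (nil ∙ nil)
    (case (var zero)
      (case (var (suc zero)) (nil ∙ nil) nil)
      (case (var (suc (suc (suc zero)))) nil
        (case (call zero (var (suc (suc zero)) ∙ var zero)) nil
          (call zero (var (suc (suc (suc (suc (suc zero))))) ∙ var (suc (suc (suc zero))))))))

  -- Each recursive call visits a different node of `s`, so 15 steps per node of `s` suffice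
  -- whatever `t` is.
  eq-runs : ∀ s t → Within (λ _ → eq-body) (s ∙ t ∷ []) eq-body (eq s t) (∣ s ∣ᵗ * 15)
  eq-runs nil     nil     = within-≤ (m≤m+n 9 6)
    (within-case-∙ (within-var zero) (within-case-nil (within-var zero)
      (within-case-nil (within-var (suc zero)) (within-∙ within-nil within-nil))))
  eq-runs nil     (_ ∙ _) = within-≤ (m≤m+n 7 8)
    (within-case-∙ (within-var zero) (within-case-nil (within-var zero)
      (within-case-∙ (within-var (suc zero)) within-nil)))
  eq-runs (a ∙ b) nil     = within-≤ (+-mono-≤ (m≤m+n 7 8) z≤n)
    (within-case-∙ (within-var zero) (within-case-∙ (within-var zero)
      (within-case-nil (within-var _) within-nil)))
  eq-runs (a ∙ b) (c ∙ d) = within-≤ (≤-reflexive (arith ∣ a ∣ᵗ ∣ b ∣ᵗ))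
    (within-case-∙ (within-var zero) (within-case-∙ (within-var zero) (within-case-∙ (within-var _)
      (within-and (within-call (within-∙ (within-var _) (within-var _)) (eq-runs a c))
        (λ _ _ → within-call (within-∙ (within-var _) (within-var _)) (eq-runs b d)) (s≤s z≤n)))))
    where
    arith : ∀ m n → 6 + suc (suc (3 + m * 15) + suc (3 + n * 15)) ≡ suc (m + n) * 15
    arith = solve-∀

  ∣eq∣≤3 : ∀ s t → ∣ eq s t ∣ᵗ ≤ 3
  ∣eq∣≤3 nil     nil     = ≤-refl
  ∣eq∣≤3 nil     (_ ∙ _) = s≤s z≤n
  ∣eq∣≤3 (_ ∙ _) nil     = s≤s z≤n
  ∣eq∣≤3 (a ∙ b) (c ∙ d) with eq a c
  ... | nil   = s≤s z≤n
  ... | _ ∙ _ = ∣eq∣≤3 b d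

eqᵖ : ∀ {f g} → PolyTime f → PolyTime g → PolyTime (λ x → eq (f x) (g x))
eqᵖ F G = composeᵖ eq-polyTime (pairᵖ F G)
  where
  eq-polyTime : PolyTime (λ x → eq (fst x) (snd x))
  eq-polyTime .functions      = 0
  eq-polyTime .program _      = eq-body
  eq-polyTime .time           = X ⊗ K 15
  eq-polyTime .size           = K 3
  eq-polyTime .runs nil       = within-≤ (m≤m+n 5 10)
    (within-case-nil (within-var zero) (within-∙ within-nil within-nil))
  eq-polyTime .runs x@(s ∙ t) = within-≤ (*-monoˡ-≤ 15 (∣fst∣≤ x)) (eq-runs s t)
  eq-polyTime .bounded x      = ∣eq∣≤3 (fst x) (snd x)

-- Trees as lists: nil is the empty list and _∙_ is cons.

infixr 5 _++ᵗ_

_++ᵗ_ : Tree → Tree → Tree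
nil     ++ᵗ m = m
(a ∙ l) ++ᵗ m = a ∙ (l ++ᵗ m)

concatMapᵗ : (Tree → Tree) → Tree → Tree
concatMapᵗ f nil     = nil
concatMapᵗ f (a ∙ l) = f a ++ᵗ concatMapᵗ f l

∣++ᵗ∣≤ : ∀ l m → ∣ l ++ᵗ m ∣ᵗ ≤ ∣ l ∣ᵗ + ∣ m ∣ᵗ
∣++ᵗ∣≤ nil     m = n≤1+n _
∣++ᵗ∣≤ (a ∙ l) m = s≤s (≤-trans (+-monoʳ-≤ ∣ a ∣ᵗ (∣++ᵗ∣≤ l m))
                                (≤-reflexive (sym (+-assoc ∣ a ∣ᵗ _ _))))

∣concatMapᵗ∣≤ : ∀ f {N S} → (∀ a → ∣ a ∣ᵗ ≤ N → ∣ f a ∣ᵗ ≤ S) →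
                ∀ l → ∣ l ∣ᵗ ≤ N → ∣ concatMapᵗ f l ∣ᵗ ≤ ∣ l ∣ᵗ * suc S
∣concatMapᵗ∣≤ f         f≤ nil     l≤ = s≤s z≤n
∣concatMapᵗ∣≤ f {S = S} f≤ (a ∙ l) l≤ = ≤-trans (∣++ᵗ∣≤ (f a) (concatMapᵗ f l))
  (+-mono-≤ (m≤n⇒m≤1+n (f≤ a (≤-trans (∣fst∣≤ (a ∙ l)) l≤)))
    (≤-trans (∣concatMapᵗ∣≤ f f≤ l (≤-trans (∣snd∣≤ (a ∙ l)) l≤))
             (*-monoˡ-≤ (suc S) (m≤n+m _ ∣ a ∣ᵗ))))

++ᵖ : ∀ {f g} → PolyTime f → PolyTime g → PolyTime (λ x → f x ++ᵗ g x)
++ᵖ F G = composeᵖ append (pairᵖ G F)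
  where
  -- `recᵖ` recurses on the second component, so the suffix is the environment and comes first.
  append : PolyTime (λ x → snd x ++ᵗ fst x)
  append = recᵖ idᵖ
    (pairᵖ (composeᵖ fstᵖ (composeᵖ fstᵖ sndᵖ)) (composeᵖ sndᵖ (composeᵖ sndᵖ sndᵖ)))
    (λ m l → l ++ᵗ m) (λ _ → refl) (λ _ _ _ → refl) X
    (λ m l → ≤-trans (∣++ᵗ∣≤ l m) (m≤n⇒m≤1+n (≤-reflexive (+-comm ∣ l ∣ᵗ ∣ m ∣ᵗ))))

-- The body of the loop receives the environment paired with the list element.
concatMapᵖ : ∀ {g : Tree → Tree → Tree} {l} → PolyTime (λ z → g (fst z) (snd z)) → PolyTime l →
             PolyTime (λ x → concatMapᵗ (g x) (l x))
concatMapᵖ {g} G L = composeᵖ loop (pairᵖ idᵖ L)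
  where
  loop : PolyTime (λ x → concatMapᵗ (g (fst x)) (snd x))
  loop = recᵖ nilᵖ
    (++ᵖ (composeᵖ G (pairᵖ fstᵖ (composeᵖ fstᵖ (composeᵖ fstᵖ sndᵖ))))
         (composeᵖ sndᵖ (composeᵖ sndᵖ sndᵖ)))
    (λ x → concatMapᵗ (g x)) (λ _ → refl) (λ _ _ _ → refl) (X ⊗ (K 1 ⊕ size G))
    (λ x l → ≤-trans
      (∣concatMapᵗ∣≤ (g x)
        (λ a a≤ → ≤-trans (bounded G (x ∙ a)) (⟦⟧ᵖ-mono (size G) (s≤s (+-monoʳ-≤ ∣ x ∣ᵗ a≤))))
        l ≤-refl)
      (*-monoˡ-≤ (suc (⟦ size G ⟧ᵖ ∣ x ∙ l ∣ᵗ)) (∣snd∣≤ (x ∙ l))))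

-- Since non-`nil` means true, `concatMapᵗ` acts as an existential quantifier over the list.
member : Tree → Tree → Tree
member a l = concatMapᵗ (eq a) l

memberᵖ : ∀ {a l} → PolyTime a → PolyTime l → PolyTime (λ x → member (a x) (l x))
memberᵖ A L = concatMapᵖ (eqᵖ (composeᵖ A fstᵖ) sndᵖ) L

filterᵗ : (Tree → Tree) → Tree → Tree
filterᵗ p l = concatMapᵗ (λ a → if-nil (p a) nil (a ∙ nil)) l

∣filterᵗ∣≤ : ∀ p l → ∣ filterᵗ p l ∣ᵗ ≤ ∣ l ∣ᵗ
∣filterᵗ∣≤ p nil     = ≤-refl
∣filterᵗ∣≤ p (a ∙ l) with p a
... | nil   = ≤-trans (∣filterᵗ∣≤ p l) (∣snd∣≤ (a ∙ l))
... | _ ∙ _ = s≤s (+-monoʳ-≤ ∣ a ∣ᵗ (∣filterᵗ∣≤ p l))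

filterᵖ : ∀ {p : Tree → Tree → Tree} {l} → PolyTime (λ z → p (fst z) (snd z)) → PolyTime l →
          PolyTime (λ x → filterᵗ (p x) (l x))
filterᵖ P L = concatMapᵖ (ifᵖ P nilᵖ (pairᵖ sndᵖ nilᵖ)) L

-- Operations on the subsets of a frame given by the list W of its worlds and
-- the list E of its labelled edges R ∙ u ∙ v; a valuation is a list of pairs i ∙ w.

truthSet : Tree → Tree → Tree → Tree
truthSet W U i = filterᵗ (λ w → member (i ∙ w) U) W

meet : Tree → Tree → Tree → Tree
meet W A B = filterᵗ (λ w → member w A and member w B) W

diamond : Tree → Tree → Tree → Tree → Tree
diamond W E R A = filterᵗ (λ w → concatMapᵗ (λ v → member (R ∙ w ∙ v) E and member v A) W) W

truthSetᵖ : ∀ {W U i} → PolyTime W → PolyTime U → PolyTime i →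
            PolyTime (λ x → truthSet (W x) (U x) (i x))
truthSetᵖ W U i = filterᵖ (memberᵖ (pairᵖ (composeᵖ i fstᵖ) sndᵖ) (composeᵖ U fstᵖ)) W

meetᵖ : ∀ {W A B} → PolyTime W → PolyTime A → PolyTime B →
        PolyTime (λ x → meet (W x) (A x) (B x))
meetᵖ W A B = filterᵖ (andᵖ (memberᵖ sndᵖ (composeᵖ A fstᵖ)) (memberᵖ sndᵖ (composeᵖ B fstᵖ))) W

diamondᵖ : ∀ {W E R A} → PolyTime W → PolyTime E → PolyTime R → PolyTime A →
           PolyTime (λ x → diamond (W x) (E x) (R x) (A x))
diamondᵖ W E R A = filterᵖ
  (concatMapᵖ
    (andᵖ (memberᵖ (pairᵖ (outer R) (pairᵖ (composeᵖ sndᵖ fstᵖ) sndᵖ)) (outer E))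
          (memberᵖ sndᵖ (outer A)))
    (composeᵖ W fstᵖ))
  W
  where
  outer : ∀ {f} → PolyTime f → PolyTime (λ z → f (fst (fst z)))
  outer F = composeᵖ F (composeᵖ fstᵖ fstᵖ)

module _ (W E U : Tree) where

  -- The tags are those of `encodeᶠ`: `nil` for a variable, `nil ∙ nil` for a conjunction,
  -- `(nil ∙ nil) ∙ nil` for a diamond. `⊤` is the tree `nil` and is handled by `evaluation`.
  connective : Tree → Tree → Tree → Tree
  connective tag r sets =
    if-nil tag (truthSet W U r)
      (if-nil (fst tag) (meet W (fst sets) (snd sets)) (diamond W E (fst r) (snd sets)))

  -- The truth set of the formula encoded by a tree, paired with those of its
  -- two immediate subtrees: an argument of a connective lies two levels below
  -- the root of the encoding, out of reach of plain structural recursion.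
  evaluation : Tree → Tree
  evaluation nil     = W ∙ nil ∙ nil
  evaluation (t ∙ r) = connective t r (snd (evaluation r)) ∙ fst (evaluation t) ∙ fst (evaluation r)

  eval : Tree → Tree
  eval φ = fst (evaluation φ)

  ∣connective∣≤ : ∀ t r s → ∣ connective t r s ∣ᵗ ≤ ∣ W ∣ᵗ
  ∣connective∣≤ nil           r s = ∣filterᵗ∣≤ _ W
  ∣connective∣≤ (nil ∙ _)     r s = ∣filterᵗ∣≤ _ W
  ∣connective∣≤ ((_ ∙ _) ∙ _) r s = ∣filterᵗ∣≤ _ W

  -- Every truth set is `W` or filtered from it. This is the size bound that bounded recursion
  -- demands in advance.
  ∣eval∣≤ : ∀ φ → ∣ eval φ ∣ᵗ ≤ ∣ W ∣ᵗ
  ∣eval∣≤ nil     = ≤-refl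
  ∣eval∣≤ (t ∙ r) = ∣connective∣≤ t r (snd (evaluation r))

  ∣evaluation∣≤ : ∀ φ → ∣ evaluation φ ∣ᵗ ≤ 2 + (∣ W ∣ᵗ + (∣ W ∣ᵗ + ∣ W ∣ᵗ))
  ∣evaluation∣≤ nil = ≤-trans (≤-reflexive (+-suc (suc ∣ W ∣ᵗ) 2))
    (+-monoʳ-≤ (2 + ∣ W ∣ᵗ) (+-mono-≤ (1≤∣∣ᵗ W) (1≤∣∣ᵗ W)))
  ∣evaluation∣≤ (t ∙ r) = ≤-trans (≤-reflexive (+-suc (suc ∣ eval (t ∙ r) ∣ᵗ) _))
    (+-mono-≤ (s≤s (s≤s (∣eval∣≤ (t ∙ r)))) (+-mono-≤ (∣eval∣≤ t) (∣eval∣≤ r)))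

evalᵖ : ∀ {W E U φ} → PolyTime W → PolyTime E → PolyTime U → PolyTime φ →
        PolyTime (λ x → eval (W x) (E x) (U x) (φ x))
evalᵖ W E U φ = composeᵖ fstᵖ (composeᵖ evaluation-polyTime (pairᵖ (pairᵖ W (pairᵖ E U)) φ))
  where
  Wᵖ : PolyTime (λ x → fst (fst x))
  Wᵖ = composeᵖ fstᵖ fstᵖ
  Eᵖ : PolyTime (λ x → fst (snd (fst x)))
  Eᵖ = composeᵖ fstᵖ (composeᵖ sndᵖ fstᵖ)
  Uᵖ : PolyTime (λ x → snd (snd (fst x)))
  Uᵖ = composeᵖ sndᵖ (composeᵖ sndᵖ fstᵖ)
  tag : PolyTime (λ x → fst (fst (snd x)))
  tag = composeᵖ fstᵖ (composeᵖ fstᵖ sndᵖ)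
  arg : PolyTime (λ x → snd (fst (snd x)))
  arg = composeᵖ sndᵖ (composeᵖ fstᵖ sndᵖ)
  left : PolyTime (λ x → fst (snd (snd x)))
  left = composeᵖ fstᵖ (composeᵖ sndᵖ sndᵖ)
  right : PolyTime (λ x → snd (snd (snd x)))
  right = composeᵖ sndᵖ (composeᵖ sndᵖ sndᵖ)
  sets : PolyTime (λ x → snd (snd (snd (snd x))))
  sets = composeᵖ sndᵖ right
  evaluation-polyTime : PolyTime (λ x → evaluation (fst (fst x)) (fst (snd (fst x))) (snd (snd (fst x))) (snd x))
  evaluation-polyTime = recᵖ
    (pairᵖ fstᵖ (constᵖ true))
    (pairᵖ
      (ifᵖ tag (truthSetᵖ Wᵖ Uᵖ arg)
        (ifᵖ (composeᵖ fstᵖ tag)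
          (meetᵖ Wᵖ (composeᵖ fstᵖ sets) (composeᵖ sndᵖ sets))
          (diamondᵖ Wᵖ Eᵖ (composeᵖ fstᵖ arg) (composeᵖ sndᵖ sets))))
      (pairᵖ (composeᵖ fstᵖ left) (composeᵖ fstᵖ right)))
    (λ env → evaluation (fst env) (fst (snd env)) (snd (snd env)))
    (λ _ → refl) (λ _ _ _ → refl)
    (K 2 ⊕ (X ⊕ (X ⊕ X)))
    (λ env φ → ≤-trans (∣evaluation∣≤ (fst env) (fst (snd env)) (snd (snd env)) φ)
      (+-monoʳ-≤ 2 (+-mono-≤ (W≤ env φ) (+-mono-≤ (W≤ env φ) (W≤ env φ)))))
    where
    W≤ : ∀ env φ → ∣ fst env ∣ᵗ ≤ ∣ env ∙ φ ∣ᵗ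
    W≤ env φ = ≤-trans (∣fst∣≤ env) (∣fst∣≤ (env ∙ φ))

-- The certificate verifier

module _ {𝓡 : Set} (code : 𝓡 ↣ ℕ) where

  encodeᴿ : 𝓡 → Tree
  encodeᴿ R = encodeℕ (Injection.to code R)

  module _ (W E : Tree) where

    -- One valuation for every homomorphism from the tree of σ that sends the root to w.
    minimalValuations : SpFormula 𝓡 → Tree → Tree
    minimalValuations (var i) w = ((encodeℕ i ∙ w) ∙ nil) ∙ nil
    minimalValuations ⊤       w = nil ∙ nil
    minimalValuations (σ ∧ τ) w =
      concatMapᵗ (λ A → concatMapᵗ (λ B → (A ++ᵗ B) ∙ nil) (minimalValuations τ w)) (minimalValuations σ w)
    minimalValuations (◇ R σ) w =
      concatMapᵗ (λ v → member (encodeᴿ R ∙ w ∙ v) E and minimalValuations σ v) W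

    -- Read as a truth value: non-`nil` if the consequent fails under some minimal valuation of the
    -- antecedent.
    failures : SpImplication 𝓡 → Tree
    failures (σ ⟶ τ) =
      concatMapᵗ (λ w → concatMapᵗ (λ U → not (member w (eval W E U (encodeᶠ code τ))))
                                   (minimalValuations σ w)) W

    allFailures : List (SpImplication 𝓡) → Tree
    allFailures []      = nil
    allFailures (κ ∷ Σ) = failures κ ++ᵗ allFailures Σ

  -- The recursion on `σ` takes place while the program is built, not while it runs: the loops are
  -- nested according to `σ`. The bound depends on `σ`, which comes from a fixed axiom and not from
  -- the input.
  minimalValuationsᵖ : ∀ σ {W E w} → PolyTime W → PolyTime E → PolyTime w →
                       PolyTime (λ x → minimalValuations (W x) (E x) σ (w x))
  minimalValuationsᵖ (var i) W E w = pairᵖ (pairᵖ (pairᵖ (constᵖ (encodeℕ i)) w) nilᵖ) nilᵖ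
  minimalValuationsᵖ ⊤       W E w = constᵖ (nil ∙ nil)
  minimalValuationsᵖ (σ ∧ τ) W E w = concatMapᵖ
    (concatMapᵖ (pairᵖ (++ᵖ (composeᵖ sndᵖ fstᵖ) sndᵖ) nilᵖ)
      (minimalValuationsᵖ τ (composeᵖ W fstᵖ) (composeᵖ E fstᵖ) (composeᵖ w fstᵖ)))
    (minimalValuationsᵖ σ W E w)
  minimalValuationsᵖ (◇ R σ) W E w = concatMapᵖ
    (andᵖ (memberᵖ (pairᵖ (constᵖ (encodeᴿ R)) (pairᵖ (composeᵖ w fstᵖ) sndᵖ)) (composeᵖ E fstᵖ))
          (minimalValuationsᵖ σ (composeᵖ W fstᵖ) (composeᵖ E fstᵖ) sndᵖ))
    W

  failuresᵖ : ∀ κ {W E} → PolyTime W → PolyTime E → PolyTime (λ x → failures (W x) (E x) κ)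
  failuresᵖ (σ ⟶ τ) W E = concatMapᵖ
    (concatMapᵖ
      (notᵖ (memberᵖ (composeᵖ sndᵖ fstᵖ)
        (evalᵖ (composeᵖ W (composeᵖ fstᵖ fstᵖ)) (composeᵖ E (composeᵖ fstᵖ fstᵖ)) sndᵖ (constᵖ (encodeᶠ code τ)))))
      (minimalValuationsᵖ σ (composeᵖ W fstᵖ) (composeᵖ E fstᵖ) sndᵖ))
    W

  allFailuresᵖ : ∀ Σ {W E} → PolyTime W → PolyTime E → PolyTime (λ x → allFailures (W x) (E x) Σ)
  allFailuresᵖ []      W E = nilᵖ
  allFailuresᵖ (κ ∷ Σ) W E = ++ᵖ (failuresᵖ κ W E) (allFailuresᵖ Σ W E)

  -- φ and ψ encode the two sides of the implication to be refuted; a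
  -- certificate has the form (W ∙ E) ∙ (V ∙ w).
  refutes : List (SpImplication 𝓡) → (φ ψ W E V w : Tree) → Tree
  refutes Σ φ ψ W E V w =
    not (allFailures W E Σ) and member w W and member w (eval W E V φ) and not (member w (eval W E V ψ))

  verifier : List (SpImplication 𝓡) → Tree → Tree
  verifier Σ x = refutes Σ (fst (fst x)) (snd (fst x))
    (fst (fst (snd x))) (snd (fst (snd x))) (fst (snd (snd x))) (snd (snd (snd x)))

  abstract
    verifierᵖ : ∀ Σ → PolyTime (verifier Σ)
    verifierᵖ Σ = andᵖ (notᵖ (allFailuresᵖ Σ W E)) (andᵖ (memberᵖ w W)
      (andᵖ (memberᵖ w (evalᵖ W E V (composeᵖ fstᵖ fstᵖ)))
            (notᵖ (memberᵖ w (evalᵖ W E V (composeᵖ sndᵖ fstᵖ))))))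
      where
      W : PolyTime (λ x → fst (fst (snd x)))
      W = composeᵖ fstᵖ (composeᵖ fstᵖ sndᵖ)
      E : PolyTime (λ x → snd (fst (snd x)))
      E = composeᵖ sndᵖ (composeᵖ fstᵖ sndᵖ)
      V : PolyTime (λ x → fst (snd (snd x)))
      V = composeᵖ fstᵖ (composeᵖ sndᵖ sndᵖ)
      w : PolyTime (λ x → snd (snd (snd x)))
      w = composeᵖ sndᵖ (composeᵖ sndᵖ sndᵖ)

-- Correctness of the encodings and of the list and set operations

∙-injectiveˡ : ∀ {a b c d : Tree} → a ∙ b ≡ c ∙ d → a ≡ c
∙-injectiveˡ refl = refl

∙-injectiveʳ : ∀ {a b c d : Tree} → a ∙ b ≡ c ∙ d → b ≡ d
∙-injectiveʳ refl = refl

encodeᵇ-injective : ∀ a b → encodeᵇ a ≡ encodeᵇ b → a ≡ b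
encodeᵇ-injective zero     zero     _ = refl
encodeᵇ-injective 2[1+ a ] 2[1+ b ] p = cong 2[1+_] (encodeᵇ-injective a b (∙-injectiveʳ p))
encodeᵇ-injective 1+[2 a ] 1+[2 b ] p = cong 1+[2_] (encodeᵇ-injective a b (∙-injectiveʳ p))

encodeℕ-injective : ∀ {m n} → encodeℕ m ≡ encodeℕ n → m ≡ n
encodeℕ-injective {m} {n} p = fromℕ-injective (encodeᵇ-injective (fromℕ m) (fromℕ n) p)

infix 4 _∈ᵗ_

data _∈ᵗ_ (a : Tree) : Tree → Set where
  here  : ∀ {l} → a ∈ᵗ a ∙ l
  there : ∀ {b l} → a ∈ᵗ l → a ∈ᵗ b ∙ l

∈⇒≢nil : ∀ {a l} → a ∈ᵗ l → l ≢ nil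
∈⇒≢nil here      ()
∈⇒≢nil (there _) ()

≢nil⇒∈ : ∀ {l} → l ≢ nil → ∃[ a ] a ∈ᵗ l
≢nil⇒∈ {nil}   l≢ = contradiction refl l≢
≢nil⇒∈ {a ∙ l} l≢ = a , here

singleton : ∀ {a b} → a ∈ᵗ b ∙ nil → a ≡ b
singleton here = refl

∈-++⁺ˡ : ∀ {a l m} → a ∈ᵗ l → a ∈ᵗ l ++ᵗ m
∈-++⁺ˡ here      = here
∈-++⁺ˡ (there p) = there (∈-++⁺ˡ p)

∈-++⁺ʳ : ∀ {a} l {m} → a ∈ᵗ m → a ∈ᵗ l ++ᵗ m
∈-++⁺ʳ nil     p = p
∈-++⁺ʳ (_ ∙ l) p = there (∈-++⁺ʳ l p)

∈-++⁻ : ∀ {a} l {m} → a ∈ᵗ l ++ᵗ m → a ∈ᵗ l ⊎ a ∈ᵗ m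
∈-++⁻ nil     p         = inj₂ p
∈-++⁻ (_ ∙ l) here      = inj₁ here
∈-++⁻ (_ ∙ l) (there p) with ∈-++⁻ l p
... | inj₁ q = inj₁ (there q)
... | inj₂ q = inj₂ q

∈-concatMap⁺ : ∀ f {a b l} → a ∈ᵗ l → b ∈ᵗ f a → b ∈ᵗ concatMapᵗ f l
∈-concatMap⁺ f         here              q = ∈-++⁺ˡ q
∈-concatMap⁺ f {l = c ∙ _} (there p) q = ∈-++⁺ʳ (f c) (∈-concatMap⁺ f p q)

∈-concatMap⁻ : ∀ f l {b} → b ∈ᵗ concatMapᵗ f l → ∃[ a ] a ∈ᵗ l × b ∈ᵗ f a
∈-concatMap⁻ f (a ∙ l) p with ∈-++⁻ (f a) p
... | inj₁ q = a , here , q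
... | inj₂ q with ∈-concatMap⁻ f l q
... | b , b∈ , r = b , there b∈ , r

concatMap-≢nil⁺ : ∀ f {a l} → a ∈ᵗ l → f a ≢ nil → concatMapᵗ f l ≢ nil
concatMap-≢nil⁺ f p q = ∈⇒≢nil (∈-concatMap⁺ f p (proj₂ (≢nil⇒∈ q)))

concatMap-≢nil⁻ : ∀ f {l} → concatMapᵗ f l ≢ nil → ∃[ a ] a ∈ᵗ l × f a ≢ nil
concatMap-≢nil⁻ f {l} p with ∈-concatMap⁻ f l (proj₂ (≢nil⇒∈ p))
... | a , a∈ , q = a , a∈ , ∈⇒≢nil q

and⁺ : ∀ {s t} → s ≢ nil → t ≢ nil → s and t ≢ nil
and⁺ {nil}   p q = contradiction refl p
and⁺ {_ ∙ _} p q = q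

and⁻ : ∀ {s t} → s and t ≢ nil → s ≢ nil × t ≢ nil
and⁻ {nil}   p = contradiction refl p
and⁻ {_ ∙ _} p = (λ ()) , p

∈-and⁺ : ∀ {s t a} → s ≢ nil → a ∈ᵗ t → a ∈ᵗ s and t
∈-and⁺ {nil}   p q = contradiction refl p
∈-and⁺ {_ ∙ _} p q = q

∈-and⁻ : ∀ {s t a} → a ∈ᵗ s and t → s ≢ nil × a ∈ᵗ t
∈-and⁻ {_ ∙ _} p = (λ ()) , p

not⁺ : ∀ {t} → ¬ t ≢ nil → not t ≢ nil
not⁺ {nil}   _ ()
not⁺ {_ ∙ _} p = contradiction (λ ()) p

not⁻ : ∀ {t} → not t ≢ nil → ¬ t ≢ nil
not⁻ {nil}   _ q = q refl
not⁻ {_ ∙ _} p _ = p refl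

eq⁺ : ∀ a → eq a a ≢ nil
eq⁺ nil     ()
eq⁺ (a ∙ b) = and⁺ (eq⁺ a) (eq⁺ b)

eq⁻ : ∀ a b → eq a b ≢ nil → a ≡ b
eq⁻ nil     nil     _ = refl
eq⁻ nil     (_ ∙ _) p = contradiction refl p
eq⁻ (_ ∙ _) nil     p = contradiction refl p
eq⁻ (a ∙ b) (c ∙ d) p with and⁻ {eq a c} p
... | q , r = cong₂ _∙_ (eq⁻ a c q) (eq⁻ b d r)

member⁺ : ∀ {a l} → a ∈ᵗ l → member a l ≢ nil
member⁺ {a} p = concatMap-≢nil⁺ (eq a) p (eq⁺ a)

member⁻ : ∀ {a l} → member a l ≢ nil → a ∈ᵗ l
member⁻ {a} p with concatMap-≢nil⁻ (eq a) p
... | b , b∈ , q with refl ← eq⁻ a b q = b∈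

∈-filter⁺ : ∀ p {a l} → a ∈ᵗ l → p a ≢ nil → a ∈ᵗ filterᵗ p l
∈-filter⁺ p {a} a∈ q = ∈-concatMap⁺ (λ b → if-nil (p b) nil (b ∙ nil)) a∈ (kept q)
  where
  kept : ∀ {t} → t ≢ nil → a ∈ᵗ if-nil t nil (a ∙ nil)
  kept {nil}   q = contradiction refl q
  kept {_ ∙ _} _ = here

∈-filter⁻ : ∀ p {a} l → a ∈ᵗ filterᵗ p l → a ∈ᵗ l × p a ≢ nil
∈-filter⁻ p {a} l q with ∈-concatMap⁻ (λ b → if-nil (p b) nil (b ∙ nil)) l q
... | b , b∈ , r with kept r
  where
  kept : ∀ {t} → a ∈ᵗ if-nil t nil (b ∙ nil) → t ≢ nil × a ≡ b
  kept {_ ∙ _} here = (λ ()) , refl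
... | pb≢nil , refl = b∈ , pb≢nil

module _ (W : Tree) where

  ∈-truthSet⁺ : ∀ {U i w} → w ∈ᵗ W → i ∙ w ∈ᵗ U → w ∈ᵗ truthSet W U i
  ∈-truthSet⁺ {U} {i} w∈ p = ∈-filter⁺ (λ w → member (i ∙ w) U) w∈ (member⁺ p)

  ∈-truthSet⁻ : ∀ U i {w} → w ∈ᵗ truthSet W U i → i ∙ w ∈ᵗ U
  ∈-truthSet⁻ U i p = member⁻ (proj₂ (∈-filter⁻ (λ w → member (i ∙ w) U) W p))

  ∈-meet⁺ : ∀ {A B w} → w ∈ᵗ W → w ∈ᵗ A → w ∈ᵗ B → w ∈ᵗ meet W A B
  ∈-meet⁺ {A} {B} w∈ p q =
    ∈-filter⁺ (λ w → member w A and member w B) w∈ (and⁺ (member⁺ p) (member⁺ q))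

  ∈-meet⁻ : ∀ A B {w} → w ∈ᵗ meet W A B → w ∈ᵗ A × w ∈ᵗ B
  ∈-meet⁻ A B {w} p
    with and⁻ {member w A} (proj₂ (∈-filter⁻ (λ w → member w A and member w B) W p))
  ... | q , r = member⁻ q , member⁻ r

  ∈-diamond⁺ : ∀ {E R A w v} → w ∈ᵗ W → v ∈ᵗ W → R ∙ w ∙ v ∈ᵗ E → v ∈ᵗ A → w ∈ᵗ diamond W E R A
  ∈-diamond⁺ {E} {R} {A} {w} w∈ v∈ p q =
    ∈-filter⁺ (λ w → concatMapᵗ (λ v → member (R ∙ w ∙ v) E and member v A) W) w∈
      (concatMap-≢nil⁺ (λ v → member (R ∙ w ∙ v) E and member v A) v∈ (and⁺ (member⁺ p) (member⁺ q)))

  ∈-diamond⁻ : ∀ E R A {w} → w ∈ᵗ diamond W E R A → ∃[ v ] v ∈ᵗ W × R ∙ w ∙ v ∈ᵗ E × v ∈ᵗ A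
  ∈-diamond⁻ E R A {w} p
    with concatMap-≢nil⁻ (λ v → member (R ∙ w ∙ v) E and member v A) (proj₂ (∈-filter⁻
           (λ w → concatMapᵗ (λ v → member (R ∙ w ∙ v) E and member v A) W) W p))
  ... | v , v∈ , q with and⁻ {member (R ∙ w ∙ v) E} q
  ... | r , s = v , v∈ , member⁻ r , member⁻ s

-- The algebra of subsets and correctness of the verifier

module _ {𝓡 : Set} (A : SLO 𝓡) where
  open SLO A
  private module M = BoundedMeetSemilattice semilattice

  []-mono : ∀ σ {𝔞 𝔟 : ℕ → Carrier} → (∀ i → 𝔞 i ≤ᴬ 𝔟 i) → σ [ 𝔞 ] ≤ᴬ σ [ 𝔟 ]
  []-mono (var i) 𝔞≤𝔟 = 𝔞≤𝔟 i
  []-mono ⊤       𝔞≤𝔟 = M.refl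
  []-mono (σ ∧ τ) 𝔞≤𝔟 = M.∧-greatest (M.trans (M.x∧y≤x _ _) ([]-mono σ 𝔞≤𝔟))
                                      (M.trans (M.x∧y≤y _ _) ([]-mono τ 𝔞≤𝔟))
  []-mono (◇ R σ) 𝔞≤𝔟 = ◇-mono R ([]-mono σ 𝔞≤𝔟)

-- `W` and `E` are arbitrary trees: every certificate, however malformed, yields an SLO, so its
-- format never has to be checked.
module FrameAlgebra {𝓡 : Set} (code : 𝓡 ↣ ℕ) (W E : Tree) where

  infix 4 _⊆_

  -- Any tree counts as a set of worlds; comparing only on `W` makes `W` the top element.
  _⊆_ : Tree → Tree → Set
  A ⊆ B = ∀ {w} → w ∈ᵗ W → w ∈ᵗ A → w ∈ᵗ B

  algebra : SLO 𝓡
  algebra = record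
    { semilattice = record
      { Carrier = Tree
      ; _≈_ = λ A B → A ⊆ B × B ⊆ A
      ; _≤_ = _⊆_
      ; _∧_ = meet W
      ; ⊤ = W
      ; isBoundedMeetSemilattice = record
        { isMeetSemilattice = record
          { isPartialOrder = record
            { isPreorder = record
              { isEquivalence = record
                { refl  = (λ _ p → p) , (λ _ p → p)
                ; sym   = λ (p , q) → q , p
                ; trans = λ (p , q) (r , s) → (λ w∈ x → r w∈ (p w∈ x)) , (λ w∈ x → q w∈ (s w∈ x))
                }
              ; reflexive = proj₁
              ; trans = λ p q w∈ x → q w∈ (p w∈ x)
              }
            ; antisym = _,_
            }
          ; infimum = λ A B →
              (λ _ p → proj₁ (∈-meet⁻ W A B p)) , (λ _ p → proj₂ (∈-meet⁻ W A B p)) ,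
              (λ C p q w∈ x → ∈-meet⁺ W w∈ (p w∈ x) (q w∈ x))
          }
        ; maximum = λ _ w∈ _ → w∈
        }
      }
    ; ◇ᴬ = λ R → diamond W E (encodeᴿ code R)
    ; ◇-mono = λ R {A} p w∈ x →
        let (v , v∈ , e , v∈A) = ∈-diamond⁻ W E (encodeᴿ code R) A x
        in ∈-diamond⁺ W w∈ v∈ e (p v∈ v∈A)
    }

  open SLO algebra using (_[_])

  valuation : Tree → ℕ → Tree
  valuation U i = truthSet W U (encodeℕ i)

  -- An equality of trees and not merely up to `_≈_`, so the verifier's computation can be rewritten
  -- into the algebra.
  eval≡[valuation] : ∀ U σ → eval W E U (encodeᶠ code σ) ≡ σ [ valuation U ]
  eval≡[valuation] U (var i) = refl
  eval≡[valuation] U ⊤       = refl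
  eval≡[valuation] U (σ ∧ τ) = cong₂ (meet W) (eval≡[valuation] U σ) (eval≡[valuation] U τ)
  eval≡[valuation] U (◇ R σ) = cong (diamond W E (encodeᴿ code R)) (eval≡[valuation] U σ)

  valuation-mono : ∀ {U V} → (∀ {t} → t ∈ᵗ U → t ∈ᵗ V) → ∀ i → valuation U i ⊆ valuation V i
  valuation-mono {U} U⊆V i w∈ p = ∈-truthSet⁺ W w∈ (U⊆V (∈-truthSet⁻ W U (encodeℕ i) p))

  -- For a conjunction the two valuations are merged, and enlarging a valuation preserves truth.
  minimalValuations-sound : ∀ σ {w U} → w ∈ᵗ W → U ∈ᵗ minimalValuations code W E σ w →
                            w ∈ᵗ σ [ valuation U ]
  minimalValuations-sound (var i) {U = U} w∈ here = ∈-truthSet⁺ W {U} {encodeℕ i} w∈ here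
  minimalValuations-sound ⊤       w∈ _    = w∈
  minimalValuations-sound (σ ∧ τ) {w} w∈ p
    with A , A∈ , q ← ∈-concatMap⁻ _ (minimalValuations code W E σ w) p
    with B , B∈ , here ← ∈-concatMap⁻ _ (minimalValuations code W E τ w) q
    = ∈-meet⁺ W w∈
        ([]-mono algebra σ (valuation-mono {A} {A ++ᵗ B} ∈-++⁺ˡ) w∈ (minimalValuations-sound σ w∈ A∈))
        ([]-mono algebra τ (valuation-mono {B} {A ++ᵗ B} (∈-++⁺ʳ A)) w∈ (minimalValuations-sound τ w∈ B∈))
  minimalValuations-sound (◇ R σ) {w} w∈ p
    with v , v∈ , q ← ∈-concatMap⁻ (λ v → member (encodeᴿ code R ∙ w ∙ v) E and minimalValuations code W E σ v) W p
    with r , s ← ∈-and⁻ q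
    = ∈-diamond⁺ W {E} {encodeᴿ code R} w∈ v∈ (member⁻ r) (minimalValuations-sound σ v∈ s)

  -- The worlds witnessing the truth of `σ` form a homomorphic image of its tree; the valuation
  -- listed for it contains only facts that hold under `𝔞`.
  minimalValuations-complete : ∀ σ 𝔞 {w} → w ∈ᵗ W → w ∈ᵗ σ [ 𝔞 ] →
    ∃[ U ] U ∈ᵗ minimalValuations code W E σ w × (∀ i → valuation U i ⊆ 𝔞 i)
  minimalValuations-complete (var i) 𝔞 {w} w∈ p = _ , here , λ j _ q → below j (∈-truthSet⁻ W _ (encodeℕ j) q)
    where
    below : ∀ j {v} → encodeℕ j ∙ v ∈ᵗ (encodeℕ i ∙ w) ∙ nil → v ∈ᵗ 𝔞 j
    below j r with singleton r
    ... | eq′ with refl ← encodeℕ-injective {j} {i} (∙-injectiveˡ eq′) | refl ← ∙-injectiveʳ eq′ = p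
  minimalValuations-complete ⊤       𝔞 w∈ p =
    nil , here , λ i _ q → contradiction (∈-truthSet⁻ W nil (encodeℕ i) q) λ ()
  minimalValuations-complete (σ ∧ τ) 𝔞 w∈ p
    with q , r ← ∈-meet⁻ W (σ [ 𝔞 ]) (τ [ 𝔞 ]) p
    with A , A∈ , A≤ ← minimalValuations-complete σ 𝔞 w∈ q
    with B , B∈ , B≤ ← minimalValuations-complete τ 𝔞 w∈ r
    = A ++ᵗ B , ∈-concatMap⁺ _ A∈ (∈-concatMap⁺ _ B∈ here) , λ i v∈ s →
        [ (λ s′ → A≤ i v∈ (∈-truthSet⁺ W v∈ s′)) , (λ s′ → B≤ i v∈ (∈-truthSet⁺ W v∈ s′)) ]′
          (∈-++⁻ A (∈-truthSet⁻ W (A ++ᵗ B) (encodeℕ i) s))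
  minimalValuations-complete (◇ R σ) 𝔞 {w} w∈ p
    with v , v∈ , e , q ← ∈-diamond⁻ W E (encodeᴿ code R) (σ [ 𝔞 ]) p
    with U , U∈ , U≤ ← minimalValuations-complete σ 𝔞 v∈ q
    = U , ∈-concatMap⁺ (λ v → member (encodeᴿ code R ∙ w ∙ v) E and minimalValuations code W E σ v)
            v∈ (∈-and⁺ (member⁺ e) U∈) , U≤

  -- `τ` holds under a minimal valuation below `𝔞`, hence under `𝔞` by monotonicity. As `_≢ nil` is
  -- a negation, arguing by contradiction here is constructive.
  failures-sound : ∀ κ → ¬ failures code W E κ ≢ nil → algebra ⊨ᴬ κ
  failures-sound (σ ⟶ τ) none 𝔞 {w} w∈ p
    with U , U∈ , U≤ ← minimalValuations-complete σ 𝔞 w∈ p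
    = []-mono algebra τ U≤ w∈ (subst (w ∈ᵗ_) (eval≡[valuation] U τ) (member⁻ λ w∉ →
        none (concatMap-≢nil⁺ (λ w → concatMapᵗ (λ U → not (member w (eval W E U (encodeᶠ code τ))))
                                                (minimalValuations code W E σ w)) w∈
             (concatMap-≢nil⁺ (λ U → not (member w (eval W E U (encodeᶠ code τ)))) U∈
               (not⁺ λ w∈′ → w∈′ w∉)))))

  failures-complete : ∀ κ → algebra ⊨ᴬ κ → ¬ failures code W E κ ≢ nil
  failures-complete (σ ⟶ τ) valid some
    with w , w∈ , p ← concatMap-≢nil⁻ (λ w → concatMapᵗ (λ U → not (member w (eval W E U (encodeᶠ code τ))))
                                                (minimalValuations code W E σ w)) some
    with U , U∈ , q ← concatMap-≢nil⁻ (λ U → not (member w (eval W E U (encodeᶠ code τ)))) p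
    = not⁻ q (member⁺ (subst (w ∈ᵗ_) (sym (eval≡[valuation] U τ))
        (valid (valuation U) w∈ (minimalValuations-sound σ w∈ U∈))))

  allFailures-sound : ∀ Σ → ¬ allFailures code W E Σ ≢ nil → ∀ κ → κ ∈ Σ → algebra ⊨ᴬ κ
  allFailures-sound (κ ∷ Σ) none .κ (here refl) =
    failures-sound κ λ some → none (∈⇒≢nil (∈-++⁺ˡ (proj₂ (≢nil⇒∈ some))))
  allFailures-sound (κ ∷ Σ) none κ′ (there κ′∈) =
    allFailures-sound Σ (λ some → none (∈⇒≢nil (∈-++⁺ʳ (failures code W E κ) (proj₂ (≢nil⇒∈ some))))) κ′ κ′∈

  allFailures-complete : ∀ Σ → (∀ κ → κ ∈ Σ → algebra ⊨ᴬ κ) → ¬ allFailures code W E Σ ≢ nil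
  allFailures-complete []      valid some = some refl
  allFailures-complete (κ ∷ Σ) valid some with ∈-++⁻ (failures code W E κ) (proj₂ (≢nil⇒∈ some))
  ... | inj₁ p = failures-complete κ (valid κ (here refl)) (∈⇒≢nil p)
  ... | inj₂ p = allFailures-complete Σ (λ κ′ κ′∈ → valid κ′ (there κ′∈)) (∈⇒≢nil p)

  -- `SPi+` quantifies over all SLOs validating the axioms, and the algebra of an accepted
  -- certificate is one of them.
  refutes-sound : ∀ Σ σ τ V w → refutes code Σ (encodeᶠ code σ) (encodeᶠ code τ) W E V w ≢ nil →
                  ¬ SPi+ (_∈ Σ) (σ ⟶ τ)
  refutes-sound Σ σ τ V w accepted derivable
    with p , q ← and⁻ {not (allFailures code W E Σ)} accepted
    with w∈ , r ← and⁻ {member w W} q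
    with w∈σ , w∉τ ← and⁻ {member w (eval W E V (encodeᶠ code σ))} r
    rewrite eval≡[valuation] V σ | eval≡[valuation] V τ
    = not⁻ w∉τ (member⁺ {w} (derivable algebra (allFailures-sound Σ (not⁻ p)) (valuation V)
                           (member⁻ w∈) (member⁻ w∈σ)))

  refutes-complete : ∀ Σ σ τ V w → (∀ κ → κ ∈ Σ → algebra ⊨ᴬ κ) → w ∈ᵗ W →
    w ∈ᵗ σ [ valuation V ] → ¬ w ∈ᵗ τ [ valuation V ] →
    refutes code Σ (encodeᶠ code σ) (encodeᶠ code τ) W E V w ≢ nil
  refutes-complete Σ σ τ V w valid w∈ w∈σ w∉τ
    rewrite eval≡[valuation] V σ | eval≡[valuation] V τ
    = and⁺ (not⁺ (allFailures-complete Σ valid)) (and⁺ (member⁺ w∈) (and⁺ (member⁺ w∈σ)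
        (not⁺ λ w∈τ → w∉τ (member⁻ w∈τ))))

-- Certificates

infixr 7 _×ᵗ_

_×ᵗ_ : Tree → Tree → Tree
A ×ᵗ B = concatMapᵗ (λ a → concatMapᵗ (λ b → (a ∙ b) ∙ nil) B) A

∈-×⁺ : ∀ {a b A B} → a ∈ᵗ A → b ∈ᵗ B → a ∙ b ∈ᵗ A ×ᵗ B
∈-×⁺ a∈ b∈ = ∈-concatMap⁺ _ a∈ (∈-concatMap⁺ _ b∈ here)

abstract
  -- Serves to bound the size of products, through its fields `size` and `bounded`.
  ×ᵖ : PolyTime (λ x → fst x ×ᵗ snd x)
  ×ᵖ = concatMapᵖ
    (concatMapᵖ (pairᵖ (pairᵖ (composeᵖ sndᵖ fstᵖ) sndᵖ) nilᵖ) (composeᵖ sndᵖ fstᵖ)) fstᵖ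

∣×∣≤ : ∀ A B {m n} → ∣ A ∣ᵗ ≤ m → ∣ B ∣ᵗ ≤ n → ∣ A ×ᵗ B ∣ᵗ ≤ ⟦ size ×ᵖ ⟧ᵖ (suc (m + n))
∣×∣≤ A B A≤ B≤ = ≤-trans (bounded ×ᵖ (A ∙ B)) (⟦⟧ᵖ-mono (size ×ᵖ) (s≤s (+-mono-≤ A≤ B≤)))

∈⇒∣∣≤ : ∀ {a l} → a ∈ᵗ l → ∣ a ∣ᵗ ≤ ∣ l ∣ᵗ
∈⇒∣∣≤ {l = l} here            = ∣fst∣≤ l
∈⇒∣∣≤ {l = l} (there p) = ≤-trans (∈⇒∣∣≤ p) (∣snd∣≤ l)

-- Codes of variables and diamonds occur as subtrees of an encoding, so this list contains all of
-- them; the other subtrees in it do no harm.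
subtrees : Tree → Tree
subtrees nil     = nil ∙ nil
subtrees (a ∙ b) = (a ∙ b) ∙ (subtrees a ++ᵗ subtrees b)

-- Each node contributes one subtree of size at most `N`, plus constant overhead for the list.
∣subtrees∣≤ : ∀ t {N} → ∣ t ∣ᵗ ≤ N → ∣ subtrees t ∣ᵗ ≤ ∣ t ∣ᵗ * (3 + N)
∣subtrees∣≤ nil     {N} t≤ = ≤-trans (m≤m+n 3 N) (m≤m+n (3 + N) 0)
∣subtrees∣≤ (a ∙ b) {N} t≤ = +-mono-≤ {suc ∣ a ∙ b ∣ᵗ}
  (≤-trans (s≤s t≤) (m≤n+m (suc N) 2))
  (≤-trans (∣++ᵗ∣≤ (subtrees a) (subtrees b))
    (≤-trans (+-mono-≤ (∣subtrees∣≤ a (≤-trans (∣fst∣≤ (a ∙ b)) t≤))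
                       (∣subtrees∣≤ b (≤-trans (∣snd∣≤ (a ∙ b)) t≤)))
             (≤-reflexive (sym (*-distribʳ-+ (3 + N) ∣ a ∣ᵗ ∣ b ∣ᵗ)))))

infix 4 _⊑_

_⊑_ : Tree → Tree → Set
s ⊑ S = ∀ {t} → t ∈ᵗ subtrees s → t ∈ᵗ S

⊑⇒∈ : ∀ s {S} → s ⊑ S → s ∈ᵗ S
⊑⇒∈ nil     s⊑ = s⊑ here
⊑⇒∈ (_ ∙ _) s⊑ = s⊑ here

⊑-left : ∀ {a b S} → a ∙ b ⊑ S → a ⊑ S
⊑-left s⊑ p = s⊑ (there (∈-++⁺ˡ p))

⊑-right : ∀ {a b S} → a ∙ b ⊑ S → b ⊑ S
⊑-right {a} s⊑ p = s⊑ (there (∈-++⁺ʳ (subtrees a) p))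

-- Worlds are named in unary, which is affordable because their number is at most the size of the
-- implication.
numeral : ℕ → Tree
numeral zero    = nil
numeral (suc k) = nil ∙ numeral k

numeral-injective : ∀ k l → numeral k ≡ numeral l → k ≡ l
numeral-injective zero    zero    _ = refl
numeral-injective (suc k) (suc l) p = cong suc (numeral-injective k l (∙-injectiveʳ p))

numerals : ℕ → Tree
numerals zero    = nil
numerals (suc n) = numeral n ∙ numerals n

∈-numerals⁺ : ∀ {k n} → k < n → numeral k ∈ᵗ numerals n
∈-numerals⁺ {k} {suc n} (s≤s k≤n) with m≤n⇒m<n∨m≡n k≤n
... | inj₁ k<n  = there (∈-numerals⁺ k<n)
... | inj₂ refl = here

∈-numerals⁻ : ∀ n {t} → t ∈ᵗ numerals n → ∃[ k ] k < n × t ≡ numeral k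
∈-numerals⁻ (suc n) here      = n , ≤-refl , refl
∈-numerals⁻ (suc n) (there p) with ∈-numerals⁻ n p
... | k , k<n , eq′ = k , m<n⇒m<1+n k<n , eq′

∣numeral∣≤ : ∀ k {N} → k ≤ N → ∣ numeral k ∣ᵗ ≤ suc (N * 2)
∣numeral∣≤ zero    _       = s≤s z≤n
∣numeral∣≤ (suc k) (s≤s p) = s≤s (s≤s (∣numeral∣≤ k p))

∣numerals∣≤ : ∀ n {N} → n ≤ N → ∣ numerals n ∣ᵗ ≤ suc (n * (2 + N * 2))
∣numerals∣≤ zero        _   = ≤-refl
∣numerals∣≤ (suc n) {N} n<N = s≤s (≤-trans
  (+-mono-≤ (∣numeral∣≤ n (<⇒≤ n<N)) (∣numerals∣≤ n (<⇒≤ n<N)))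
  (≤-reflexive (+-suc (suc (N * 2)) (n * (2 + N * 2)))))

truthValue : ∀ {P : Set} → Dec P → Tree
truthValue (yes _) = true
truthValue (no  _) = nil

truthValue⁺ : ∀ {P : Set} (P? : Dec P) → P → truthValue P? ≢ nil
truthValue⁺ (yes _) _ ()
truthValue⁺ (no ¬p) p = contradiction p ¬p

truthValue⁻ : ∀ {P : Set} (P? : Dec P) → truthValue P? ≢ nil → P
truthValue⁻ (yes p) _ = p
truthValue⁻ (no  _) q = contradiction refl q

-- Worlds are counted against the number of symbols, certificates against the size of the encoding;
-- this links the two measures.
∣encodeᶠ∣≥ : ∀ {𝓡} (code : 𝓡 ↣ ℕ) σ → ∣ σ ∣ᶠ ≤ ∣ encodeᶠ code σ ∣ᵗ
∣encodeᶠ∣≥ code (var i) = s≤s z≤n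
∣encodeᶠ∣≥ code ⊤       = ≤-refl
∣encodeᶠ∣≥ code (σ ∧ τ) = s≤s (≤-trans (+-mono-≤ (∣encodeᶠ∣≥ code σ) (∣encodeᶠ∣≥ code τ)) (m≤n+m _ 4))
∣encodeᶠ∣≥ code (◇ R σ) = s≤s (≤-trans (∣encodeᶠ∣≥ code σ)
  (≤-trans (m≤n+m _ ∣ encodeᴿ code R ∣ᵗ) (m≤n+m _ 6)))

∣encodeⁱ∣≥ : ∀ {𝓡} (code : 𝓡 ↣ ℕ) ι → ∣ ι ∣ⁱ ≤ ∣ encodeⁱ code ι ∣ᵗ
∣encodeⁱ∣≥ code (σ ⟶ τ) = s≤s (+-mono-≤ (∣encodeᶠ∣≥ code σ) (∣encodeᶠ∣≥ code τ))

encodeAll : ∀ {𝓡} → 𝓡 ↣ ℕ → List (SpImplication 𝓡) → Tree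
encodeAll code []      = nil
encodeAll code (κ ∷ Σ) = encodeⁱ code κ ∙ encodeAll code Σ

∈⇒⊑ : ∀ {𝓡} (code : 𝓡 ↣ ℕ) {κ Σ S} → κ ∈ Σ → encodeAll code Σ ⊑ S → encodeⁱ code κ ⊑ S
∈⇒⊑ code {κ} {_ ∷ Σ} (here refl) Σ⊑ = ⊑-left {encodeⁱ code κ} {encodeAll code Σ} Σ⊑
∈⇒⊑ code {Σ = κ′ ∷ Σ} (there κ∈) Σ⊑ = ∈⇒⊑ code κ∈ (⊑-right {encodeⁱ code κ′} {encodeAll code Σ} Σ⊑)

-- A finite frame is described only on the symbols whose codes occur in S.
module Description (em : ExcludedMiddle 0ℓ) {𝓡 : Set} (code : 𝓡 ↣ ℕ)
                   (F : Frame 𝓡) {n : ℕ} (F↔Fin : Frame.W F ↔ Fin n) (S : Tree) where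
  open Frame F

  world : W → Tree
  world x = numeral (toℕ (Inverse.to F↔Fin x))

  worlds : Tree
  worlds = numerals n

  world-injective : ∀ {x y} → world x ≡ world y → x ≡ y
  world-injective {x} {y} p = trans (sym (Inverse.strictlyInverseʳ F↔Fin x))
    (trans (cong (Inverse.from F↔Fin) (toℕ-injective (numeral-injective _ _ p)))
           (Inverse.strictlyInverseʳ F↔Fin y))

  world∈worlds : ∀ x → world x ∈ᵗ worlds
  world∈worlds x = ∈-numerals⁺ (toℕ<n (Inverse.to F↔Fin x))

  ∈worlds⇒world : ∀ {w} → w ∈ᵗ worlds → ∃[ x ] w ≡ world x
  ∈worlds⇒world w∈ with k , k<n , refl ← ∈-numerals⁻ n w∈ =
    Inverse.from F↔Fin (fromℕ< k<n) , cong numeral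
      (sym (trans (cong toℕ (Inverse.strictlyInverseˡ F↔Fin (fromℕ< k<n))) (toℕ-fromℕ< k<n)))

  Edge : Tree → Set
  Edge t = ∃[ R ] ∃[ x ] ∃[ y ] t ≡ encodeᴿ code R ∙ world x ∙ world y × rel R x y

  -- A certificate only has to exist, so excluded middle may select its edges.
  edges : Tree
  edges = filterᵗ (λ t → truthValue (em {Edge t})) (S ×ᵗ worlds ×ᵗ worlds)

  ∈-edges⁺ : ∀ {R x y} → encodeᴿ code R ∈ᵗ S → rel R x y → encodeᴿ code R ∙ world x ∙ world y ∈ᵗ edges
  ∈-edges⁺ {R} {x} {y} R∈ Rxy = ∈-filter⁺ (λ t → truthValue (em {Edge t}))
    (∈-×⁺ R∈ (∈-×⁺ (world∈worlds x) (world∈worlds y))) (truthValue⁺ em (R , x , y , refl , Rxy))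

  ∈-edges⁻ : ∀ {R x y} → encodeᴿ code R ∙ world x ∙ world y ∈ᵗ edges → rel R x y
  ∈-edges⁻ {R} p with truthValue⁻ em (proj₂ (∈-filter⁻ (λ t → truthValue (em {Edge t})) (S ×ᵗ worlds ×ᵗ worlds) p))
  ... | R′ , x′ , y′ , eq′ , Rxy
    with refl ← Injection.injective code {R} {R′} (encodeℕ-injective (∙-injectiveˡ eq′))
       | refl ← world-injective (∙-injectiveˡ (∙-injectiveʳ eq′))
       | refl ← world-injective (∙-injectiveʳ (∙-injectiveʳ eq′)) = Rxy

  module _ (V : ℕ → Pred W 0ℓ) where

    Fact : Tree → Set
    Fact t = ∃[ i ] ∃[ x ] t ≡ encodeℕ i ∙ world x × V i x

    facts : Tree
    facts = filterᵗ (λ t → truthValue (em {Fact t})) (S ×ᵗ worlds)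

    ∈-facts⁺ : ∀ {i x} → encodeℕ i ∈ᵗ S → V i x → encodeℕ i ∙ world x ∈ᵗ facts
    ∈-facts⁺ {i} {x} i∈ Vix = ∈-filter⁺ (λ t → truthValue (em {Fact t}))
      (∈-×⁺ i∈ (world∈worlds x)) (truthValue⁺ em (i , x , refl , Vix))

    ∈-facts⁻ : ∀ {i x} → encodeℕ i ∙ world x ∈ᵗ facts → V i x
    ∈-facts⁻ {i} p with truthValue⁻ em (proj₂ (∈-filter⁻ (λ t → truthValue (em {Fact t})) (S ×ᵗ worlds) p))
    ... | i′ , x′ , eq′ , Vix
      with refl ← encodeℕ-injective {i} {i′} (∙-injectiveˡ eq′)
         | refl ← world-injective (∙-injectiveʳ eq′) = Vix

  open FrameAlgebra code worlds edges
  open SLO algebra using (_[_])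

  module _ {V : ℕ → Pred W 0ℓ} {𝔞 : ℕ → Tree} where

    -- The symbols of `σ` must occur in `S`, because edges with other labels are left out of the
    -- description.
    truth⁺ : (∀ {i x} → encodeℕ i ∈ᵗ S → V i x → world x ∈ᵗ 𝔞 i) →
             ∀ σ → encodeᶠ code σ ⊑ S → ∀ {x} → ⟦ σ ⟧ V x → world x ∈ᵗ σ [ 𝔞 ]
    truth⁺ h (var i) σ⊑ s = h (⊑⇒∈ (encodeℕ i) (⊑-right {nil} {encodeℕ i} σ⊑)) s
    truth⁺ h ⊤       σ⊑ s = world∈worlds _
    truth⁺ h (σ ∧ τ) σ⊑ (s , t) = ∈-meet⁺ worlds (world∈worlds _)
      (truth⁺ h σ (⊑-left {encodeᶠ code σ} {encodeᶠ code τ} args⊑) s)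
      (truth⁺ h τ (⊑-right {encodeᶠ code σ} {encodeᶠ code τ} args⊑) t)
      where
      args⊑ : encodeᶠ code σ ∙ encodeᶠ code τ ⊑ S
      args⊑ = ⊑-right {nil ∙ nil} {encodeᶠ code σ ∙ encodeᶠ code τ} σ⊑
    truth⁺ h (◇ R σ) σ⊑ (y , Rxy , s) = ∈-diamond⁺ worlds (world∈worlds _) (world∈worlds y)
      (∈-edges⁺ (⊑⇒∈ (encodeᴿ code R) (⊑-left {encodeᴿ code R} {encodeᶠ code σ} args⊑)) Rxy)
      (truth⁺ h σ (⊑-right {encodeᴿ code R} {encodeᶠ code σ} args⊑) s)
      where
      args⊑ : encodeᴿ code R ∙ encodeᶠ code σ ⊑ S
      args⊑ = ⊑-right {(nil ∙ nil) ∙ nil} {encodeᴿ code R ∙ encodeᶠ code σ} σ⊑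

    -- The description may omit edges but never invents any, so this direction covers all formulas.
    truth⁻ : (∀ {i x} → world x ∈ᵗ 𝔞 i → V i x) →
             ∀ σ {x} → world x ∈ᵗ σ [ 𝔞 ] → ⟦ σ ⟧ V x
    truth⁻ h (var i) p = h p
    truth⁻ h ⊤       p = tt
    truth⁻ h (σ ∧ τ) p with q , r ← ∈-meet⁻ worlds (σ [ 𝔞 ]) (τ [ 𝔞 ]) p = truth⁻ h σ q , truth⁻ h τ r
    truth⁻ h (◇ R σ) p
      with v , v∈ , e , q ← ∈-diamond⁻ worlds edges (encodeᴿ code R) (σ [ 𝔞 ]) p
      with y , refl ← ∈worlds⇒world v∈
      = y , ∈-edges⁻ {R} e , truth⁻ h σ q

  -- An assignment in the algebra pulls back along `world` to a valuation on `F`, where validity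
  -- applies.
  algebra-⊨ : ∀ κ → encodeⁱ code κ ⊑ S → F ⊨ κ → algebra ⊨ᴬ κ
  algebra-⊨ (σ ⟶ τ) κ⊑ valid 𝔞 w∈ p with x , refl ← ∈worlds⇒world w∈ =
    truth⁺ (λ _ q → q) τ (⊑-right {encodeᶠ code σ} {encodeᶠ code τ} κ⊑)
      (valid (λ i y → world y ∈ᵗ 𝔞 i) x (truth⁻ (λ q → q) σ p))

module _ {𝓡 : Set} (code : 𝓡 ↣ ℕ) (Σ : List (SpImplication 𝓡)) where

  private
    symbolsSize worldsSize edgesSize factsSize : Poly
    -- The bound of `∣subtrees∣≤` at the size of the input joined with the axioms, which contribute
    -- a constant.
    symbolsSize = (X ⊗ (K 3 ⊕ X)) ⊚ (K 1 ⊕ (X ⊕ K ∣ encodeAll code Σ ∣ᵗ))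
    worldsSize  = K 1 ⊕ X ⊗ (K 2 ⊕ X ⊗ K 2)
    edgesSize   = size ×ᵖ ⊚ (K 1 ⊕ (symbolsSize ⊕ size ×ᵖ ⊚ (K 1 ⊕ (worldsSize ⊕ worldsSize))))
    factsSize   = size ×ᵖ ⊚ (K 1 ⊕ (symbolsSize ⊕ worldsSize))

  certificateSize : Poly
  certificateSize = K 1 ⊕ ((K 1 ⊕ (worldsSize ⊕ edgesSize)) ⊕ (K 1 ⊕ (factsSize ⊕ worldsSize)))

  certificate : ExcludedMiddle (lsuc 0ℓ) →
    ∀ ι (F : Frame 𝓡) → (∀ κ → κ ∈ Σ → F ⊨ κ) → ¬ (F ⊨ ι) →
    ∀ {n} → n ≤ ∣ ι ∣ⁱ → Frame.W F ↔ Fin n →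
    ∃[ y ] ∣ y ∣ᵗ ≤ ⟦ certificateSize ⟧ᵖ ∣ encodeⁱ code ι ∣ᵗ × verifier code Σ (encodeⁱ code ι ∙ y) ≢ nil
  certificate em ι@(σ ⟶ τ) F F⊨Σ F⊭ι {n} n≤ F↔Fin
    with V , w , s , ¬t ← ⊭⇒countermodel em F σ τ F⊭ι
    = (worlds ∙ edges) ∙ (facts V ∙ world w) , y≤ ,
      refutes-complete Σ σ τ (facts V) (world w)
        (λ κ κ∈ → algebra-⊨ κ (∈⇒⊑ code κ∈ (⊑-right {x} {encodeAll code Σ} (λ p → p))) (F⊨Σ κ κ∈))
        (world∈worlds w)
        (truth⁺ (λ i∈ Vix → ∈-truthSet⁺ worlds (world∈worlds _) (∈-facts⁺ V i∈ Vix))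
          σ (⊑-left {encodeᶠ code σ} {encodeᶠ code τ} x⊑) s)
        (λ w∈τ → ¬t (truth⁻ (λ {i} p → ∈-facts⁻ V {i} (∈-truthSet⁻ worlds (facts V) (encodeℕ i) p)) τ w∈τ))
    where
    x S : Tree
    x = encodeⁱ code ι
    S = subtrees (x ∙ encodeAll code Σ)
    open Description (lowerEM em) code F F↔Fin S
    open FrameAlgebra code worlds edges
    x⊑ : x ⊑ S
    x⊑ = ⊑-left {x} {encodeAll code Σ} (λ p → p)
    n≤∣x∣ : n ≤ ∣ x ∣ᵗ
    n≤∣x∣ = ≤-trans n≤ (∣encodeⁱ∣≥ code ι)
    S≤ : ∣ S ∣ᵗ ≤ ⟦ symbolsSize ⟧ᵖ ∣ x ∣ᵗ
    S≤ = ∣subtrees∣≤ (x ∙ encodeAll code Σ) ≤-refl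
    worlds≤ : ∣ worlds ∣ᵗ ≤ ⟦ worldsSize ⟧ᵖ ∣ x ∣ᵗ
    worlds≤ = ≤-trans (∣numerals∣≤ n n≤∣x∣) (s≤s (*-monoˡ-≤ (2 + ∣ x ∣ᵗ * 2) n≤∣x∣))
    edges≤ : ∣ edges ∣ᵗ ≤ ⟦ edgesSize ⟧ᵖ ∣ x ∣ᵗ
    edges≤ = ≤-trans (∣filterᵗ∣≤ _ (S ×ᵗ worlds ×ᵗ worlds))
      (∣×∣≤ S (worlds ×ᵗ worlds) S≤ (∣×∣≤ worlds worlds worlds≤ worlds≤))
    facts≤ : ∣ facts V ∣ᵗ ≤ ⟦ factsSize ⟧ᵖ ∣ x ∣ᵗ
    facts≤ = ≤-trans (∣filterᵗ∣≤ _ (S ×ᵗ worlds)) (∣×∣≤ S worlds S≤ worlds≤)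
    y≤ : ∣ (worlds ∙ edges) ∙ (facts V ∙ world w) ∣ᵗ ≤ ⟦ certificateSize ⟧ᵖ ∣ x ∣ᵗ
    y≤ = s≤s (+-mono-≤ (s≤s (+-mono-≤ worlds≤ edges≤))
                       (s≤s (+-mono-≤ facts≤ (≤-trans (∈⇒∣∣≤ (world∈worlds w)) worlds≤))))

-- Finite frame property and membership in coNP

complete⇒counterframe : ExcludedMiddle (lsuc 0ℓ) → ∀ {𝓡} {L : Pred (SpImplication 𝓡) (lsuc 0ℓ)} →
  Complete L → ∀ {ι} → ¬ L ι → Σ[ F ∈ Frame 𝓡 ] F ⊨* L × ¬ (F ⊨ ι)
complete⇒counterframe em complete {ι} ¬Lι = decidable-stable em λ none →
  ¬Lι (Equivalence.from (complete ι) λ F F⊨L → decidable-stable em λ F⊭ι → none (F , F⊨L , F⊭ι))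

polynomialFiniteFrameProperty : ExcludedMiddle (lsuc 0ℓ) → ∀ {𝓡} {L : Pred (SpImplication 𝓡) (lsuc 0ℓ)} →
  SubframeLogic L → PolynomialFiniteFrameProperty L
polynomialFiniteFrameProperty em subframe = coefficients X , λ ι counter →
  let (F , F⊨L , F⊭ι , n , n≤ , F↔Fin) = smallCounterframe em subframe ι counter
  in F , F⊨L , F⊭ι , n , ≤-trans n≤ (≤-reflexive (sym (coefficients-⟨⟩ X ∣ ι ∣ⁱ))) , F↔Fin

polyTime⇒inNP : ∀ {I : Set} {ℓ} (enc : I → Tree) {A : Pred I ℓ} {f} → PolyTime f → (p : Poly) →
  (∀ x → A x ⇔ (∃[ y ] ∣ y ∣ᵗ ≤ ⟦ p ⟧ᵖ ∣ enc x ∣ᵗ × f (enc x ∙ y) ≢ nil)) → InNP enc A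
polyTime⇒inNP enc {A} {f} C p A⇔ =
  functions C , program C , coefficients p , coefficients (time C) , total , λ x → mk⇔ (accepted x) (sound x)
  where
  total : ∀ x y → ∃[ v ] ∃[ t ] program C [ enc x ∙ y ]⇓ v ∣ t × t ≤ coefficients (time C) ⟨ ∣ enc x ∙ y ∣ᵗ ⟩
  total x y with runs C (enc x ∙ y)
  ... | t , d , t≤ = _ , t , d , ≤-trans t≤ (≤-reflexive (sym (coefficients-⟨⟩ (time C) _)))

  accepted : ∀ x → A x → ∃[ y ] ∣ y ∣ᵗ ≤ coefficients p ⟨ ∣ enc x ∣ᵗ ⟩ × Accepts (program C) (enc x ∙ y)
  accepted x Ax with Equivalence.to (A⇔ x) Ax
  ... | y , y≤ , y✓ with runs C (enc x ∙ y)
  ... | t , d , _ = y , ≤-trans y≤ (≤-reflexive (sym (coefficients-⟨⟩ p _))) , _ , t , d , y✓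

  sound : ∀ x → (∃[ y ] ∣ y ∣ᵗ ≤ coefficients p ⟨ ∣ enc x ∣ᵗ ⟩ × Accepts (program C) (enc x ∙ y)) → A x
  sound x (y , y≤ , v , _ , d , v≢nil) = Equivalence.from (A⇔ x)
    (y , ≤-trans y≤ (≤-reflexive (coefficients-⟨⟩ p _)) ,
     subst (_≢ nil) (⇓-deterministic d (proj₁ (proj₂ (runs C (enc x ∙ y))))) v≢nil)

-- Completeness provides a counterframe for a non-member, which is shrunk into a certificate;
-- conversely, the SLO of an accepted certificate excludes membership.
inCoNP : ExcludedMiddle (lsuc 0ℓ) → ∀ {𝓡} {L : Pred (SpImplication 𝓡) (lsuc 0ℓ)} →
  SubframeLogic L → Complete L → FinitelyAxiomatisable L →
  (code : 𝓡 ↣ ℕ) → InCoNP (encodeⁱ code) L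
inCoNP em {L = L} subframe complete (Σ , L⊆ , ⊆L) code =
  polyTime⇒inNP (encodeⁱ code) (verifierᵖ code Σ) (certificateSize code Σ) λ ι → mk⇔ (refutable ι) (sound ι)
  where
  Certified : SpImplication _ → Set
  Certified ι = ∃[ y ] ∣ y ∣ᵗ ≤ ⟦ certificateSize code Σ ⟧ᵖ ∣ encodeⁱ code ι ∣ᵗ ×
                       verifier code Σ (encodeⁱ code ι ∙ y) ≢ nil

  refutable : ∀ ι → ¬ L ι → Certified ι
  refutable ι ¬Lι =
    let (F , F⊨L , F⊭ι , n , n≤ , F↔Fin) =
          smallCounterframe em subframe ι (complete⇒counterframe em complete ¬Lι)
    in certificate code Σ em ι F (λ κ κ∈ → F⊨L κ (⊆L (λ A A⊨Σ → A⊨Σ κ κ∈))) F⊭ι n≤ F↔Fin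

  sound : ∀ ι → Certified ι → ¬ L ι
  sound (σ ⟶ τ) (y , _ , y✓) Lι =
    FrameAlgebra.refutes-sound code (fst (fst y)) (snd (fst y)) Σ σ τ (fst (snd y)) (snd (snd y)) y✓ (L⊆ Lι)

theorem5p1 : ExcludedMiddle (lsuc 0ℓ) →
    (𝓡 : Set) (L : Pred (SpImplication 𝓡) (lsuc 0ℓ)) →
    IsSpiLogic L → SubframeLogic L →
    PolynomialFiniteFrameProperty L ×
    (Complete L → FinitelyAxiomatisable L →
    (code : 𝓡 ↣ ℕ) → InCoNP (encodeⁱ code) L)
theorem5p1 em 𝓡 L _ subframe =
  polynomialFiniteFrameProperty em subframe , inCoNP em subframe
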